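{- Let $n\geq 10$ and let $C\subseteq\mathbb{F}^n$ be a locating-dominating code. After applying Rule 1 to the shares, every codeword $\mathbf{c}\in C$ has share $s(\mathbf{c})\leq \frac{n}{2}+1$.
   Context: $\mathbb{F}^n$ is the binary Hamming space: the set of binary words of length $n$ with the Hamming distance $d$; two words are adjacent if they are at distance $1$. $N(\mathbf{u})$ is the set of words at distance $1$ from $\mathbf{u}$ and $N[\mathbf{u}]=N(\mathbf{u})\cup\{\mathbf{u}\}$. A code is a nonempty subset $C\subseteq\mathbb{F}^n$; $I(\mathbf{u})=C\cap N[\mathbf{u}]$. $C$ is locating-dominating if $I(\mathbf{u})\neq\emptyset$ for all words $\mathbf{u}$ and $I(\mathbf{u})\neq I(\mathbf{v})$ for all distinct non-codewords $\mathbf{u},\mathbf{v}$. The (initial) share of a codeword $\mathbf{c}$ is $s(\mathbf{c})=\sum_{\mathbf{v}\in N[\mathbf{c}]}1/|I(\mathbf{v})|$. A father is a word $\mathbf{u}$ with $|I(\mathbf{u})|\geq 3$. A son is a word $\mathbf{x}$ with $|I(\mathbf{x})|=2$ and $I(\mathbf{x})\subseteq I(\mathbf{u})$ for some father $\mathbf{u}$. An orphan is a non-codeword $\mathbf{x}$ with $|I(\mathbf{x})|=1$. A codeword $\mathbf{c}$ is special if $I(\mathbf{c})=\{\mathbf{c}\}$, $N(\mathbf{c})$ contains exactly one orphan and exactly $n-2$ sons. A special father is a father adjacent to some special codeword. For a special father $\mathbf{u}$, let $C'(\mathbf{u})$ be the set of codewords $\mathbf{c}'\in I(\mathbf{u})$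 such that $\mathbf{u}$ is the only special father in $N[\mathbf{c}']$ (these sets are pairwise disjoint for distinct special fathers). Rule 1: for every special father $\mathbf{u}$, the share of each codeword in $C'(\mathbf{u})$ is replaced by the average $\frac{1}{|C'(\mathbf{u})|}\sum_{\mathbf{a}\in C'(\mathbf{u})}s(\mathbf{a})$; codewords lying in no set $C'(\mathbf{u})$ keep their share. -}

module Defs where

open import Data.Bool using (Bool; true; false; _∧_; _∨_; not; if_then_else_)
open import Data.Nat as ℕ using (ℕ; zero; suc; _≤ᵇ_; _≡ᵇ_)
open import Data.Integer using (+_)
open import Data.List using (List; []; _∷_; _++_; map; filter; length; foldr)
open import Data.Bool.ListAction using (all; any)
open import Data.Vec using (Vec; []; _∷_)
open import Data.Rational using (ℚ; _/_; 0ℚ; _+_; _*_)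
open import Data.Product using (Σ; _×_)
open import Relation.Binary.PropositionalEquality using (_≡_)
open import Relation.Nullary using (¬_)
open import Relation.Nullary.Decidable using (⌊_⌋)
open import Data.Vec.Properties using (≡-dec)
open import Data.Bool.Properties using () renaming (_≟_ to _≟B_)

Word : ℕ → Set
Word n = Vec Bool n

dist : ∀ {n} → Word n → Word n → ℕ
dist [] [] = 0
dist (a ∷ u) (b ∷ v) = (if a Data.Bool.xor b then 1 else 0) ℕ.+ dist u v
  where import Data.Bool

_==_ : ∀ {n} → Word n → Word n → Bool
u == v = ⌊ ≡-dec _≟B_ u v ⌋

allWords : (n : ℕ) → List (Word n)
allWords zero = [] ∷ []
allWords (suc n) = map (false ∷_) (allWords n) ++ map (true ∷_) (allWords n)

inN[] : ∀ {n} → Word n → Word n → Bool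
inN[] u v = dist u v ≤ᵇ 1

inN : ∀ {n} → Word n → Word n → Bool
inN u v = dist u v ≡ᵇ 1

Code : ℕ → Set
Code n = Word n → Bool

module _ {n : ℕ} (C : Code n) where

  inI : Word n → Word n → Bool
  inI u x = C x ∧ inN[] x u

  cardI : Word n → ℕ
  cardI u = length (filter (λ x → inI u x ≟B true) (allWords n))

  IsLocatingDominating : Set
  IsLocatingDominating =
    (Σ (Word n) λ c → C c ≡ true)
    × (∀ u → 1 ℕ.≤ cardI u)
    × (∀ u v → C u ≡ false → C v ≡ false → ¬ (u ≡ v)
         → ¬ (∀ x → inI u x ≡ inI v x))

  -- 1/k for k ≥ 1 (returns 0 for k = 0, which never occurs for dominating codes)
  recip : ℕ → ℚ
  recip zero = 0ℚ
  recip (suc k) = + 1 / suc k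

  sumℚ : List ℚ → ℚ
  sumℚ = foldr _+_ 0ℚ

  share : Word n → ℚ
  share c = sumℚ (map (λ v → recip (cardI v))
                      (filter (λ v → inN[] v c ≟B true) (allWords n)))

  isFather : Word n → Bool
  isFather u = 3 ≤ᵇ cardI u

  subI : Word n → Word n → Bool
  subI x u = all (λ y → not (inI x y) ∨ inI u y) (allWords n)

  isSon : Word n → Bool
  isSon x = (cardI x ≡ᵇ 2) ∧ any (λ u → isFather u ∧ subI x u) (allWords n)

  isOrphan : Word n → Bool
  isOrphan x = not (C x) ∧ (cardI x ≡ᵇ 1)

  countN : (Word n → Bool) → Word n → ℕ
  countN p c = length (filter (λ x → (inN x c ∧ p x) ≟B true) (allWords n))

  isSpecial : Word n → Bool
  isSpecial c = C c ∧ (cardI c ≡ᵇ 1) ∧ (countN isOrphan c ≡ᵇ 1)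
                ∧ (countN isSon c ≡ᵇ (n ℕ.∸ 2))

  isSpecialFather : Word n → Bool
  isSpecialFather u = isFather u ∧ any (λ c → inN c u ∧ isSpecial c) (allWords n)

  inC' : Word n → Word n → Bool
  inC' u c' = inI u c'
              ∧ all (λ v → not (inN[] v c' ∧ isSpecialFather v) ∨ (v == u)) (allWords n)

  C'list : Word n → List (Word n)
  C'list u = filter (λ c' → inC' u c' ≟B true) (allWords n)

  avgShare : Word n → ℚ
  avgShare u = sumℚ (map share (C'list u)) * recip (length (C'list u))

  -- share after Rule 1: if c ∈ C'(u) for a special father u (unique, as the
  -- sets C'(u) are pairwise disjoint), the average over C'(u); otherwise s(c).
  shareAfter : Word n → ℚ
  shareAfter c = go (allWords n)
    where
    go : List (Word n) → ℚ
    go [] = share c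
    go (u ∷ us) = if isSpecialFather u ∧ inC' u c then avgShare u else go us

{-# OPTIONS --safe #-}

-- A codeword c has share at most n/2 + 1 unless it is isolated and has an orphan neighbour. In that
-- case consider the graph on the n coordinates whose edges are the pairs {i, j} with c + i + j ∈ C:
-- neighbours c + i with degree 0, 1, ≥ 2 are orphans, sons, fathers. There is at most one orphan and
-- no isolated edge, so the degrees of the fathers bound the number of sons, and for n ≥ 10 the share
-- exceeds n/2 + 1 only if there is a single father, i.e. if c is special; the excess is then at most
-- 1/(n − 1).
--
-- A special father u is a non-codeword with exactly one non-codeword neighbour u + p. Since u + p is
-- dominated, u + p + q ∈ C for some q, and this makes the share of u + q at most n/2 + 1/(n − 1). As
-- u + q ∈ C'(u) and |C'(u)| ≤ n − 1, this deficit pays for the excess of all special codewords in C'(u).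
module Submission where

open import Agda.Builtin.Int using (pos)
import Algebra.Properties.CommutativeSemigroup as CommutativeSemigroup
import Algebra.Properties.Semiring.Sum as SemiringSum
open import Data.Bool using (Bool; true; false; _∧_; _∨_; not; if_then_else_)
open import Data.Bool.ListAction using (all; any)
open import Data.Bool.Properties using (T-≡; not-involutive; ¬-not) renaming (_≟_ to _≟B_)
open import Data.Empty using (⊥; ⊥-elim)
open import Data.Fin using (Fin; zero; suc)
open import Data.Fin.Properties using (suc-injective) renaming (_≟_ to _≟F_)
import Data.Integer as ℤ
import Data.Integer.Properties as ℤ
open import Data.List using (List; []; _∷_; _++_; map; filter; length; foldr)
open import Data.List.Membership.Propositional using (_∈_)
open import Data.List.Membership.Propositional.Properties using (∈-++⁺ˡ; ∈-++⁺ʳ; ∈-map⁺; ∈-filter⁺; ∈-filter⁻)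
open import Data.List.Relation.Unary.Any using (here; there)
open import Data.Nat as ℕ using (ℕ; zero; suc; _+_; _*_; _≤_; _≤ᵇ_; _<ᵇ_; _≡ᵇ_; z≤n; s≤s)
import Data.Nat.Properties as ℕ
open import Data.Nat.Tactic.RingSolver using (solve-∀)
open import Data.Product as Product using (∃; _×_; _,_; proj₁; proj₂)
open import Data.Rational as ℚ using (ℚ; _/_; 1ℚ)
import Data.Rational.Properties as ℚ
open import Data.Rational.Unnormalised as ℚᵘ using (mkℚᵘ; *≤*; *≡*)
import Data.Rational.Unnormalised.Properties as ℚᵘ
open import Data.Sum using (_⊎_; inj₁; inj₂)
open import Data.Vec using ([]; _∷_; tail)
open import Data.Vec.Properties using (≡-dec)
open import Defs
open import Function using (_∘_; Equivalence)
open import Relation.Binary.PropositionalEquality using (_≡_; _≢_; refl; sym; trans; cong; cong₂; subst; subst₂; module ≡-Reasoning)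
open import Relation.Nullary using (¬_; Dec; yes; no; does; contradiction)

open CommutativeSemigroup ℕ.+-commutativeSemigroup using (x∙yz≈y∙xz)
open SemiringSum ℕ.+-*-semiring using (sum; sum-cong-≗; ∑-distrib-+; ∑-comm; *-distribˡ-sum; *-distribʳ-sum)

-- Booleans and their reflection

∧-true : ∀ {a b} → a ∧ b ≡ true → a ≡ true × b ≡ true
∧-true {true} {true} _ = refl , refl

∧-intro : ∀ {a b} → a ≡ true → b ≡ true → a ∧ b ≡ true
∧-intro refl refl = refl

implication⁺ : ∀ {a b} → (a ≡ true → b ≡ true) → not a ∨ b ≡ true
implication⁺ {true}  h = h refl
implication⁺ {false} h = refl

true≢false : ∀ {a} → a ≡ true → a ≡ false → ⊥
true≢false refl ()

⇔⇒≡ : ∀ {a b} → (a ≡ true → b ≡ true) → (b ≡ true → a ≡ true) → a ≡ b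
⇔⇒≡ {true}  {b}     f g = sym (f refl)
⇔⇒≡ {false} {true}  f g = g refl
⇔⇒≡ {false} {false} f g = refl

≡ᵇ-true⁻ : ∀ {m n} → (m ≡ᵇ n) ≡ true → m ≡ n
≡ᵇ-true⁻ = ℕ.≡ᵇ⇒≡ _ _ ∘ Equivalence.from T-≡

≡ᵇ-true⁺ : ∀ {m n} → m ≡ n → (m ≡ᵇ n) ≡ true
≡ᵇ-true⁺ = Equivalence.to T-≡ ∘ ℕ.≡⇒≡ᵇ _ _

≤ᵇ-true⁻ : ∀ {m n} → (m ≤ᵇ n) ≡ true → m ≤ n
≤ᵇ-true⁻ = ℕ.≤ᵇ⇒≤ _ _ ∘ Equivalence.from T-≡

≤ᵇ-true⁺ : ∀ {m n} → m ≤ n → (m ≤ᵇ n) ≡ true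
≤ᵇ-true⁺ = Equivalence.to T-≡ ∘ ℕ.≤⇒≤ᵇ

module _ {A : Set} (p : A → Bool) where

  all-true⁺ : ∀ xs → (∀ x → p x ≡ true) → all p xs ≡ true
  all-true⁺ []       h = refl
  all-true⁺ (x ∷ xs) h rewrite h x = all-true⁺ xs h

  any-true⁺ : ∀ {x xs} → x ∈ xs → p x ≡ true → any p xs ≡ true
  any-true⁺ (here refl) px rewrite px = refl
  any-true⁺ {xs = y ∷ _} (there x∈) px with p y
  ... | true  = refl
  ... | false = any-true⁺ x∈ px

  any-true⁻ : ∀ xs → any p xs ≡ true → ∃ λ x → p x ≡ true
  any-true⁻ (x ∷ xs) h with p x in eq
  ... | true  = x , eq
  ... | false = any-true⁻ xs h

⟦_⟧ : Bool → ℕ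
⟦ true ⟧  = 1
⟦ false ⟧ = 0

⟦⟧≤1 : ∀ b → ⟦ b ⟧ ≤ 1
⟦⟧≤1 true  = s≤s z≤n
⟦⟧≤1 false = z≤n

1≤⟦⟧⇒true : ∀ {b} → 1 ≤ ⟦ b ⟧ → b ≡ true
1≤⟦⟧⇒true {true} _ = refl

-- Sums over Fin

sum-mono : ∀ {n} {f g : Fin n → ℕ} → (∀ i → f i ≤ g i) → sum f ≤ sum g
sum-mono {zero}  h = z≤n
sum-mono {suc n} h = ℕ.+-mono-≤ (h zero) (sum-mono (h ∘ suc))

sum-const : ∀ n x → sum {n} (λ _ → x) ≡ n * x
sum-const zero    x = refl
sum-const (suc n) x = cong (x +_) (sum-const n x)

-- Zeroing a term instead of deleting its index keeps the index type `Fin n`, so further terms can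
-- be split off at indices known to differ from `a`.
avoiding : ∀ {n} → Fin n → (Fin n → ℕ) → Fin n → ℕ
avoiding a f i = if does (i ≟F a) then 0 else f i

avoiding-≢ : ∀ {n} {a i : Fin n} f → i ≢ a → avoiding a f i ≡ f i
avoiding-≢ {a = a} {i} f i≢a with i ≟F a
... | yes i≡a = contradiction i≡a i≢a
... | no  _   = refl

avoiding-0 : ∀ {n} (a : Fin n) f → avoiding a f a ≡ 0
avoiding-0 a f with a ≟F a
... | yes _   = refl
... | no  a≢a = contradiction refl a≢a

sum-avoiding : ∀ {n} (a : Fin n) f → sum f ≡ f a + sum (avoiding a f)
sum-avoiding zero    f = refl
sum-avoiding (suc a) f = begin
  f zero + sum (f ∘ suc)                          ≡⟨ cong (f zero +_) (sum-avoiding a (f ∘ suc)) ⟩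
  f zero + (f (suc a) + sum (avoiding a (f ∘ suc)))  ≡⟨ x∙yz≈y∙xz (f zero) (f (suc a)) _ ⟩
  f (suc a) + (f zero + sum (avoiding a (f ∘ suc))) ≡⟨ cong (λ x → f (suc a) + (f zero + x)) (sum-cong-≗ shift) ⟩
  f (suc a) + sum (avoiding (suc a) f)            ∎
  where
  open ≡-Reasoning
  shift : ∀ i → avoiding a (f ∘ suc) i ≡ avoiding (suc a) f (suc i)
  shift i with i ≟F a
  ... | yes _ = refl
  ... | no  _ = refl

term≤sum : ∀ {n} (f : Fin n → ℕ) a → f a ≤ sum f
term≤sum f a = ℕ.≤-trans (ℕ.m≤m+n (f a) _) (ℕ.≤-reflexive (sym (sum-avoiding a f)))

two-terms≤sum : ∀ {n} (f : Fin n → ℕ) {a b} → b ≢ a → f a + f b ≤ sum f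
two-terms≤sum f {a} {b} b≢a = begin
  f a + f b                 ≡⟨ cong (f a +_) (avoiding-≢ f b≢a) ⟨
  f a + avoiding a f b      ≤⟨ ℕ.+-monoʳ-≤ (f a) (term≤sum (avoiding a f) b) ⟩
  f a + sum (avoiding a f)  ≡⟨ sum-avoiding a f ⟨
  sum f                     ∎
  where open ℕ.≤-Reasoning

three-terms≤sum : ∀ {n} (f : Fin n → ℕ) {a b c} → b ≢ a → c ≢ a → c ≢ b → f a + (f b + f c) ≤ sum f
three-terms≤sum f {a} {b} {c} b≢a c≢a c≢b = begin
  f a + (f b + f c)                        ≡⟨ cong (f a +_) (cong₂ _+_ (avoiding-≢ f b≢a) (avoiding-≢ f c≢a)) ⟨
  f a + (avoiding a f b + avoiding a f c)  ≤⟨ ℕ.+-monoʳ-≤ (f a) (two-terms≤sum (avoiding a f) c≢b) ⟩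
  f a + sum (avoiding a f)                 ≡⟨ sum-avoiding a f ⟨
  sum f                                    ∎
  where open ℕ.≤-Reasoning

positive-term : ∀ {n} (f : Fin n → ℕ) → 1 ≤ sum f → ∃ λ i → 1 ≤ f i
positive-term {suc n} f h with f zero in eq
... | suc k = zero , subst (1 ≤_) (sym eq) (s≤s z≤n)
... | zero  with positive-term (f ∘ suc) h
...   | i , p = suc i , p

sum-⟦⟧≤1 : ∀ {n} (p : Fin n → Bool) → (∀ {i j} → p i ≡ true → p j ≡ true → i ≡ j) → sum (⟦_⟧ ∘ p) ≤ 1
sum-⟦⟧≤1 {zero}  p uniq = z≤n
sum-⟦⟧≤1 {suc n} p uniq with p zero in eq
... | false = sum-⟦⟧≤1 (p ∘ suc) λ q r → suc-injective (uniq q r)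
... | true  = s≤s (ℕ.≤-reflexive (trans (sum-cong-≗ others) (trans (sum-const n 0) (ℕ.*-zeroʳ n))))
  where
  others : ∀ i → ⟦ p (suc i) ⟧ ≡ 0
  others i with p (suc i) in eq′
  ... | false = refl
  ... | true  with () ← uniq eq eq′

sum-⟦⟧≤1⁻ : ∀ {n} (p : Fin n → Bool) → sum (⟦_⟧ ∘ p) ≤ 1 → ∀ {i j} → p i ≡ true → p j ≡ true → i ≡ j
sum-⟦⟧≤1⁻ p h {i} {j} pi pj with i ≟F j
... | yes i≡j = i≡j
... | no  i≢j with ℕ.≤-trans (two-terms≤sum (⟦_⟧ ∘ p) i≢j) h
...   | q rewrite pi | pj with s≤s () ← q

-- Sums over lists

Σ[_]_ : ∀ {A : Set} → List A → (A → ℕ) → ℕ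
Σ[ xs ] f = foldr (λ x → f x +_) 0 xs

module _ {A : Set} where

  Σ-cong : ∀ {f g : A → ℕ} xs → (∀ x → f x ≡ g x) → Σ[ xs ] f ≡ Σ[ xs ] g
  Σ-cong []       h = refl
  Σ-cong (x ∷ xs) h = cong₂ _+_ (h x) (Σ-cong xs h)

  Σ-mono : ∀ {f g : A → ℕ} xs → (∀ x → f x ≤ g x) → Σ[ xs ] f ≤ Σ[ xs ] g
  Σ-mono []       h = z≤n
  Σ-mono (x ∷ xs) h = ℕ.+-mono-≤ (h x) (Σ-mono xs h)

  Σ-++ : ∀ (f : A → ℕ) xs ys → Σ[ xs ++ ys ] f ≡ Σ[ xs ] f + Σ[ ys ] f
  Σ-++ f []       ys = refl
  Σ-++ f (x ∷ xs) ys = trans (cong (f x +_) (Σ-++ f xs ys)) (sym (ℕ.+-assoc (f x) _ _))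

  Σ-map : ∀ {B : Set} (f : B → ℕ) (g : A → B) xs → Σ[ map g xs ] f ≡ Σ[ xs ] (f ∘ g)
  Σ-map f g []       = refl
  Σ-map f g (x ∷ xs) = cong (f (g x) +_) (Σ-map f g xs)

  Σ-0 : ∀ {f : A → ℕ} xs → (∀ x → f x ≡ 0) → Σ[ xs ] f ≡ 0
  Σ-0 []       h = refl
  Σ-0 (x ∷ xs) h = cong₂ _+_ (h x) (Σ-0 xs h)

  length-filter : ∀ (p : A → Bool) xs → length (filter (λ x → p x ≟B true) xs) ≡ Σ[ xs ] (⟦_⟧ ∘ p)
  length-filter p []       = refl
  length-filter p (x ∷ xs) with p x
  ... | true  = cong suc (length-filter p xs)
  ... | false = length-filter p xs

  Σ-filter : ∀ (p : A → Bool) f xs → Σ[ filter (λ x → p x ≟B true) xs ] f ≡ Σ[ xs ] (λ x → ⟦ p x ⟧ * f x)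
  Σ-filter p f []       = refl
  Σ-filter p f (x ∷ xs) with p x
  ... | true  = cong₂ _+_ (sym (ℕ.+-identityʳ (f x))) (Σ-filter p f xs)
  ... | false = Σ-filter p f xs

  -- A single entry that stays below the common bound by `G` lowers the whole sum by `G`. The
  -- averaging argument takes its deficit from here.
  Σ-gap : ∀ (f : A → ℕ) {U G a} xs → (∀ x → f x ≤ U) → a ∈ xs → f a + G ≤ U → Σ[ xs ] f + G ≤ length xs * U
  Σ-gap f {U} {G} (x ∷ xs) h (here refl) g = begin
    f x + Σ[ xs ] f + G    ≡⟨ ℕ.+-assoc (f x) _ G ⟩
    f x + (Σ[ xs ] f + G)  ≡⟨ cong (f x +_) (ℕ.+-comm _ G) ⟩
    f x + (G + Σ[ xs ] f)  ≡⟨ ℕ.+-assoc (f x) G _ ⟨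
    f x + G + Σ[ xs ] f    ≤⟨ ℕ.+-mono-≤ g (Σ≤ xs) ⟩
    U + length xs * U      ∎
    where
    open ℕ.≤-Reasoning
    Σ≤ : ∀ ys → Σ[ ys ] f ≤ length ys * U
    Σ≤ []       = z≤n
    Σ≤ (y ∷ ys) = ℕ.+-mono-≤ (h y) (Σ≤ ys)
  Σ-gap f {U} {G} (x ∷ xs) h (there a∈) g = begin
    f x + Σ[ xs ] f + G    ≡⟨ ℕ.+-assoc (f x) _ G ⟩
    f x + (Σ[ xs ] f + G)  ≤⟨ ℕ.+-mono-≤ (h x) (Σ-gap f xs h a∈ g) ⟩
    U + length xs * U      ∎
    where open ℕ.≤-Reasoning

-- Fractions

infix 8 _//_

-- m // d is m / (d + 1).
opaque
  _//_ : ℕ → ℕ → ℚ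
  m // d = pos m / suc d

  //-def : ∀ m d → m // d ≡ pos m / suc d
  //-def m d = refl

  -- `_/_` reduces to lowest terms. In unnormalised fractions the gcd disappears, and order and
  -- arithmetic become cross-multiplication.
  //-toℚᵘ : ∀ m d → ℚ.toℚᵘ (m // d) ℚᵘ.≃ mkℚᵘ (pos m) d
  //-toℚᵘ m d = ℚ.toℚᵘ-fromℚᵘ (mkℚᵘ (pos m) d)

//-≤ : ∀ {m d k e} → m * suc e ≤ k * suc d → m // d ℚ.≤ k // e
//-≤ {m} {d} {k} {e} h = ℚ.toℚᵘ-cancel-≤ (begin
  ℚ.toℚᵘ (m // d)  ≃⟨ //-toℚᵘ m d ⟩
  mkℚᵘ (pos m) d     ≤⟨ *≤* (subst₂ ℤ._≤_ (ℤ.pos-* m (suc e)) (ℤ.pos-* k (suc d)) (ℤ.+≤+ h)) ⟩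
  mkℚᵘ (pos k) e     ≃⟨ //-toℚᵘ k e ⟨
  ℚ.toℚᵘ (k // e)  ∎)
  where open ℚᵘ.≤-Reasoning

//-monoˡ : ∀ {m k} d → m ≤ k → m // d ℚ.≤ k // d
//-monoˡ {m} {k} d m≤k = //-≤ {m} {d} {k} {d} (ℕ.*-monoˡ-≤ (suc d) m≤k)

//-+ : ∀ a b d → a // d ℚ.+ b // d ≡ (a + b) // d
//-+ a b d = ℚ.toℚᵘ-injective (begin
  ℚ.toℚᵘ (a // d ℚ.+ b // d)                 ≈⟨ ℚ.toℚᵘ-homo-+ (a // d) (b // d) ⟩
  ℚ.toℚᵘ (a // d) ℚᵘ.+ ℚ.toℚᵘ (b // d)       ≈⟨ ℚᵘ.+-cong (//-toℚᵘ a d) (//-toℚᵘ b d) ⟩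
  mkℚᵘ (pos a) d ℚᵘ.+ mkℚᵘ (pos b) d             ≈⟨ *≡* common ⟩
  mkℚᵘ (pos (a + b)) d                         ≈⟨ //-toℚᵘ (a + b) d ⟨
  ℚ.toℚᵘ ((a + b) // d)                      ∎)
  where
  open import Relation.Binary.Reasoning.Setoid ℚᵘ.≃-setoid
  common : (pos a ℤ.* pos (suc d) ℤ.+ pos b ℤ.* pos (suc d)) ℤ.* pos (suc d) ≡ pos (a + b) ℤ.* pos (suc d * suc d)
  common = trans (cong (ℤ._* pos (suc d)) (sym (ℤ.*-distribʳ-+ (pos (suc d)) (pos a) (pos b))))
                 (trans (ℤ.*-assoc (pos (a + b)) (pos (suc d)) (pos (suc d)))
                        (cong (pos (a + b) ℤ.*_) (sym (ℤ.pos-* (suc d) (suc d)))))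

-- `e + d * suc e` is the predecessor of `suc d * suc e`; its successor is what that product
-- computes to.
//-* : ∀ a b d e → a // d ℚ.* b // e ≡ (a * b) // (e + d * suc e)
//-* a b d e = ℚ.toℚᵘ-injective (begin
  ℚ.toℚᵘ (a // d ℚ.* b // e)                 ≈⟨ ℚ.toℚᵘ-homo-* (a // d) (b // e) ⟩
  ℚ.toℚᵘ (a // d) ℚᵘ.* ℚ.toℚᵘ (b // e)       ≈⟨ ℚᵘ.*-cong (//-toℚᵘ a d) (//-toℚᵘ b e) ⟩
  mkℚᵘ (pos a) d ℚᵘ.* mkℚᵘ (pos b) e             ≈⟨ *≡* (cong (ℤ._* pos (suc (e + d * suc e))) (sym (ℤ.pos-* a b))) ⟩
  mkℚᵘ (pos (a * b)) (e + d * suc e)           ≈⟨ //-toℚᵘ (a * b) (e + d * suc e) ⟨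
  ℚ.toℚᵘ ((a * b) // (e + d * suc e))        ∎)
  where open import Relation.Binary.Reasoning.Setoid ℚᵘ.≃-setoid

n/2+1 : ∀ n → pos n / 2 ℚ.+ 1ℚ ≡ (n + 2) // 1
n/2+1 n = trans (cong₂ ℚ._+_ (sym (//-def n 1)) (sym (//-def 2 1))) (//-+ n 2 1)

module _ {n} (C : Code n) where

  -- An `m` with m k ≥ d + 1 is a rounded-up (d + 1) / k. Such integers turn sums of reciprocals
  -- into sums of natural numbers over one denominator.
  recip-≤ : ∀ {k m d} → suc d ≤ m * k → recip C k ℚ.≤ m // d
  recip-≤ {zero}  {m} {d} h with () ← ℕ.≤-trans h (ℕ.≤-reflexive (ℕ.*-zeroʳ m))
  recip-≤ {suc k} {m} {d} h = ℚ.≤-trans (ℚ.≤-reflexive (sym (//-def 1 k))) (//-≤ {1} {k} {m} {d} (ℕ.≤-trans (ℕ.≤-reflexive (ℕ.*-identityˡ (suc d))) h))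

  sumℚ-≤ : ∀ {A : Set} {f : A → ℚ} {g : A → ℕ} {d} xs → (∀ {x} → x ∈ xs → f x ℚ.≤ g x // d) →
           sumℚ C (map f xs) ℚ.≤ (Σ[ xs ] g) // d
  sumℚ-≤ {d = d} []   h = ℚ.≤-trans (ℚ.≤-reflexive (sym (//-def 0 0))) (//-≤ {0} {0} {0} {d} z≤n)
  sumℚ-≤ {f = f} {g} {d} (x ∷ xs) h = ℚ.≤-trans
    (ℚ.+-mono-≤ (h (here refl)) (sumℚ-≤ xs (h ∘ there)))
    (ℚ.≤-reflexive (//-+ (g x) (Σ[ xs ] g) d))

  *-recip-≤ : ∀ {x a d m b e} → x ℚ.≤ a // d → a * suc e ≤ b * (suc d * suc m) → x ℚ.* recip C (suc m) ℚ.≤ b // e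
  *-recip-≤ {x} {a} {d} {m} {b} {e} x≤ h = begin
    x ℚ.* recip C (suc m)           ≡⟨ cong (x ℚ.*_) (//-def 1 m) ⟨
    x ℚ.* 1 // m                    ≤⟨ ℚ.*-monoʳ-≤-nonNeg (1 // m) {{subst ℚ.NonNegative (sym (//-def 1 m)) (ℚ.normalize-nonNeg 1 (suc m))}} x≤ ⟩
    a // d ℚ.* 1 // m               ≡⟨ //-* a 1 d m ⟩
    (a * 1) // (m + d * suc m)      ≤⟨ //-≤ {a * 1} {m + d * suc m} {b} {e} (subst (λ y → y * suc e ≤ _) (sym (ℕ.*-identityʳ a)) h) ⟩
    b // e                          ∎
    where open ℚ.≤-Reasoning

  -- The membership makes the list nonempty, so that its length is a successor as in `*-recip-≤`.
  -- The last hypothesis is the cross-multiplied inequality.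
  average-≤ : ∀ {A : Set} {f : A → ℚ} {g : A → ℕ} {d b e a} xs → a ∈ xs → (∀ {x} → x ∈ xs → f x ℚ.≤ g x // d) →
              (Σ[ xs ] g) * suc e ≤ b * (suc d * length xs) → sumℚ C (map f xs) ℚ.* recip C (length xs) ℚ.≤ b // e
  average-≤ {f = f} {g} {d} {b} {e} xs@(_ ∷ ys) _ f≤g total =
    *-recip-≤ {sumℚ C (map f xs)} {Σ[ xs ] g} {d} {length ys} {b} {e} (sumℚ-≤ xs f≤g) total

-- The Hamming ball of radius one

-- The word u + i. By `inN⇒flip` every neighbour of `u` has this form, so neighbourhoods are indexed
-- by coordinates.
flip : ∀ {n} → Word n → Fin n → Word n
flip (b ∷ u) zero    = not b ∷ u
flip (b ∷ u) (suc i) = b ∷ flip u i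

flip-flip : ∀ {n} (u : Word n) i → flip (flip u i) i ≡ u
flip-flip (b ∷ u) zero    = cong (_∷ u) (not-involutive b)
flip-flip (b ∷ u) (suc i) = cong (b ∷_) (flip-flip u i)

flip-comm : ∀ {n} (u : Word n) i j → flip (flip u i) j ≡ flip (flip u j) i
flip-comm (b ∷ u) zero    zero    = refl
flip-comm (b ∷ u) zero    (suc j) = refl
flip-comm (b ∷ u) (suc i) zero    = refl
flip-comm (b ∷ u) (suc i) (suc j) = cong (b ∷_) (flip-comm u i j)

flip≢ : ∀ {n} (u : Word n) i → flip u i ≢ u
flip≢ (true  ∷ u) zero    ()
flip≢ (false ∷ u) zero    ()
flip≢ (b ∷ u)     (suc i) eq = flip≢ u i (cong tail eq)

flip-injective : ∀ {n} (u : Word n) {i j} → flip u i ≡ flip u j → i ≡ j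
flip-injective (b ∷ u) {zero}  {zero}  eq = refl
flip-injective (b ∷ u) {suc i} {suc j} eq = cong suc (flip-injective u (cong tail eq))
flip-injective (true  ∷ u) {zero}  {suc j} ()
flip-injective (false ∷ u) {zero}  {suc j} ()
flip-injective (true  ∷ u) {suc i} {zero}  ()
flip-injective (false ∷ u) {suc i} {zero}  ()

dist-refl : ∀ {n} (u : Word n) → dist u u ≡ 0
dist-refl []          = refl
dist-refl (true  ∷ u) = dist-refl u
dist-refl (false ∷ u) = dist-refl u

dist-flipˡ : ∀ {n} (u : Word n) i → dist (flip u i) u ≡ 1
dist-flipˡ (true  ∷ u) zero    = cong suc (dist-refl u)
dist-flipˡ (false ∷ u) zero    = cong suc (dist-refl u)
dist-flipˡ (true  ∷ u) (suc i) = dist-flipˡ u i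
dist-flipˡ (false ∷ u) (suc i) = dist-flipˡ u i

dist≡0 : ∀ {n} (u v : Word n) → dist u v ≡ 0 → u ≡ v
dist≡0 []          []          _ = refl
dist≡0 (true  ∷ u) (true  ∷ v) h = cong (true ∷_)  (dist≡0 u v h)
dist≡0 (false ∷ u) (false ∷ v) h = cong (false ∷_) (dist≡0 u v h)

dist≡1 : ∀ {n} (u v : Word n) → dist u v ≡ 1 → ∃ λ i → u ≡ flip v i
dist≡1 [] [] ()
dist≡1 (true  ∷ u) (false ∷ v) h = zero , cong (true ∷_)  (dist≡0 u v (ℕ.suc-injective h))
dist≡1 (false ∷ u) (true  ∷ v) h = zero , cong (false ∷_) (dist≡0 u v (ℕ.suc-injective h))
dist≡1 (true  ∷ u) (true  ∷ v) h with i , eq ← dist≡1 u v h = suc i , cong (true ∷_) eq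
dist≡1 (false ∷ u) (false ∷ v) h with i , eq ← dist≡1 u v h = suc i , cong (false ∷_) eq

inN⇒flip : ∀ {n} {u v : Word n} → inN u v ≡ true → ∃ λ i → u ≡ flip v i
inN⇒flip {u = u} {v} h = dist≡1 u v (≡ᵇ-true⁻ h)

inN[]⇒flip : ∀ {n} {u v : Word n} → inN[] u v ≡ true → u ≡ v ⊎ ∃ λ i → u ≡ flip v i
inN[]⇒flip {u = u} {v} h with dist u v in eq | ≤ᵇ-true⁻ {dist u v} h
... | 0 | _ = inj₁ (dist≡0 u v eq)
... | 1 | _ = inj₂ (dist≡1 u v eq)
... | suc (suc _) | s≤s ()

inN[]-refl : ∀ {n} (u : Word n) → inN[] u u ≡ true
inN[]-refl u rewrite dist-refl u = refl

inN[]-flip : ∀ {n} (u : Word n) i → inN[] (flip u i) u ≡ true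
inN[]-flip u i rewrite dist-flipˡ u i = refl

inN-flip : ∀ {n} (u : Word n) i → inN (flip u i) u ≡ true
inN-flip u i rewrite dist-flipˡ u i = refl

∈-allWords : ∀ {n} (u : Word n) → u ∈ allWords n
∈-allWords []                  = here refl
∈-allWords {suc n} (false ∷ u) = ∈-++⁺ˡ (∈-map⁺ (false ∷_) (∈-allWords u))
∈-allWords {suc n} (true  ∷ u) = ∈-++⁺ʳ (map (false ∷_) (allWords n)) (∈-map⁺ (true ∷_) (∈-allWords u))

Σ-allWords-suc : ∀ {n} (f : Word (suc n) → ℕ) →
  Σ[ allWords (suc n) ] f ≡ Σ[ allWords n ] (f ∘ (false ∷_)) + Σ[ allWords n ] (f ∘ (true ∷_))
Σ-allWords-suc {n} f = trans (Σ-++ f (map (false ∷_) (allWords n)) _)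
  (cong₂ _+_ (Σ-map f (false ∷_) (allWords n)) (Σ-map f (true ∷_) (allWords n)))

-- The test `dist v c <ᵇ 1` is what `inN[]` reduces to, one dimension up, on words that differ from
-- the centre in the first coordinate.
Σ-point : ∀ {n} (c : Word n) (f : Word n → ℕ) → Σ[ allWords n ] (λ v → ⟦ dist v c <ᵇ 1 ⟧ * f v) ≡ f c
Σ-point []      f = trans (ℕ.+-identityʳ _) (ℕ.*-identityˡ _)
Σ-point {suc n} (false ∷ c) f = begin
  _            ≡⟨ Σ-allWords-suc {n} _ ⟩
  _            ≡⟨ cong₂ _+_ (Σ-point c (f ∘ (false ∷_))) (Σ-0 (allWords n) λ _ → refl) ⟩
  f (false ∷ c) + 0   ≡⟨ ℕ.+-identityʳ _ ⟩
  f (false ∷ c) ∎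
  where open ≡-Reasoning
Σ-point {suc n} (true ∷ c) f = trans (Σ-allWords-suc {n} _)
  (cong₂ _+_ (Σ-0 (allWords n) λ _ → refl) (Σ-point c (f ∘ (true ∷_))))

-- Split by the first coordinate: the half agreeing with the centre contributes a ball in one
-- dimension less, the other half a single word, the flip at `zero`.
Σ-ball : ∀ {n} (c : Word n) (f : Word n → ℕ) →
  Σ[ allWords n ] (λ v → ⟦ inN[] v c ⟧ * f v) ≡ f c + sum (λ i → f (flip c i))
Σ-ball []      f = cong (_+ 0) (ℕ.*-identityˡ _)
Σ-ball {suc n} (false ∷ c) f = begin
  _ ≡⟨ Σ-allWords-suc {n} _ ⟩
  _ ≡⟨ cong₂ _+_ (Σ-ball c (f ∘ (false ∷_))) (Σ-point c (f ∘ (true ∷_))) ⟩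
  f (false ∷ c) + sum (λ i → f (false ∷ flip c i)) + f (true ∷ c)    ≡⟨ ℕ.+-assoc (f (false ∷ c)) _ _ ⟩
  f (false ∷ c) + (sum (λ i → f (false ∷ flip c i)) + f (true ∷ c))  ≡⟨ cong (f (false ∷ c) +_) (ℕ.+-comm _ (f (true ∷ c))) ⟩
  f (false ∷ c) + (f (true ∷ c) + sum (λ i → f (false ∷ flip c i)))  ∎
  where open ≡-Reasoning
Σ-ball {suc n} (true ∷ c) f = begin
  _ ≡⟨ Σ-allWords-suc {n} _ ⟩
  _ ≡⟨ cong₂ _+_ (Σ-point c (f ∘ (false ∷_))) (Σ-ball c (f ∘ (true ∷_))) ⟩
  f (false ∷ c) + (f (true ∷ c) + s)  ≡⟨ x∙yz≈y∙xz (f (false ∷ c)) (f (true ∷ c)) s ⟩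
  f (true ∷ c) + (f (false ∷ c) + s)  ∎
  where
  open ≡-Reasoning
  s = sum (λ i → f (true ∷ flip c i))

-- Codewords and their shares in coordinates

-- The closed ball under one index, centre first, so that `cardI` and the weight of a ball are
-- single sums over `Fin (suc n)`.
near : ∀ {n} → Word n → Fin (suc n) → Word n
near u zero    = u
near u (suc i) = flip u i

⟦∧⟧ : ∀ a b → ⟦ a ∧ b ⟧ ≡ ⟦ b ⟧ * ⟦ a ⟧
⟦∧⟧ true  true  = refl
⟦∧⟧ true  false = refl
⟦∧⟧ false true  = refl
⟦∧⟧ false false = refl

module _ {n : ℕ} (C : Code n) where

  private K = cardI C

  cardI-near : ∀ u → K u ≡ sum (λ i → ⟦ C (near u i) ⟧)
  cardI-near u = begin
    K u                                                  ≡⟨ length-filter (inI C u) (allWords n) ⟩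
    Σ[ allWords n ] (λ x → ⟦ C x ∧ inN[] x u ⟧)          ≡⟨ Σ-cong (allWords n) (λ x → ⟦∧⟧ (C x) _) ⟩
    Σ[ allWords n ] (λ x → ⟦ inN[] x u ⟧ * ⟦ C x ⟧)      ≡⟨ Σ-ball u (⟦_⟧ ∘ C) ⟩
    sum (λ i → ⟦ C (near u i) ⟧)                         ∎
    where open ≡-Reasoning

  cardI-flip : ∀ {u} → C u ≡ false → K u ≡ sum (λ i → ⟦ C (flip u i) ⟧)
  cardI-flip {u} Cu = trans (cardI-near u) (cong (λ b → ⟦ b ⟧ + sum (λ i → ⟦ C (flip u i) ⟧)) Cu)

  -- A factor `inN[]` may be inserted because neighbours lie in the closed ball. Then `Σ-ball`
  -- applies, and the centre contributes 0.
  countN-flip : ∀ p c → countN C p c ≡ sum (λ i → ⟦ p (flip c i) ⟧)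
  countN-flip p c = begin
    countN C p c                                               ≡⟨ length-filter (λ x → inN x c ∧ p x) (allWords n) ⟩
    Σ[ allWords n ] (λ x → ⟦ inN x c ∧ p x ⟧)                  ≡⟨ Σ-cong (allWords n) (λ x → restrict (dist x c) (p x)) ⟩
    Σ[ allWords n ] (λ x → ⟦ inN[] x c ⟧ * ⟦ inN x c ∧ p x ⟧)  ≡⟨ Σ-ball c (λ x → ⟦ inN x c ∧ p x ⟧) ⟩
    ⟦ inN c c ∧ p c ⟧ + sum (λ i → ⟦ inN (flip c i) c ∧ p (flip c i) ⟧)
      ≡⟨ cong₂ _+_ (cong (λ d → ⟦ (d ≡ᵇ 1) ∧ p c ⟧) (dist-refl c))
                   (sum-cong-≗ λ i → cong (λ b → ⟦ b ∧ p (flip c i) ⟧) (inN-flip c i)) ⟩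
    sum (λ i → ⟦ p (flip c i) ⟧)                               ∎
    where
    open ≡-Reasoning
    restrict : ∀ d b → ⟦ (d ≡ᵇ 1) ∧ b ⟧ ≡ ⟦ d ≤ᵇ 1 ⟧ * ⟦ (d ≡ᵇ 1) ∧ b ⟧
    restrict 0             b = refl
    restrict 1             b = sym (ℕ.+-identityʳ ⟦ b ⟧)
    restrict (suc (suc d)) b = refl

  -- `w` rounds (d + 1) / k up at every I-set size k occurring in the ball, so d + 1 times the share
  -- is at most the total weight of the ball.
  share-≤ : ∀ (w : ℕ → ℕ) {d M} c → (∀ i → suc d ≤ w (K (near c i)) * K (near c i)) →
            sum (λ i → w (K (near c i))) ≤ M → share C c ℚ.≤ M // d
  share-≤ w {d} {M} c h total = ℚ.≤-trans
    (sumℚ-≤ C {g = w ∘ K} (filter (λ v → inN[] v c ≟B true) (allWords n)) (λ v∈ → recip-≤ C {m = w (K _)} (bound v∈)))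
    (//-monoˡ d (ℕ.≤-trans (ℕ.≤-reflexive (trans (Σ-filter (λ v → inN[] v c) (w ∘ K) (allWords n)) (Σ-ball c (w ∘ K)))) total))
    where
    bound : ∀ {v} → v ∈ filter (λ v → inN[] v c ≟B true) (allWords n) → suc d ≤ w (K v) * K v
    bound {v} v∈ with inN[]⇒flip {u = v} {c} (proj₂ (∈-filter⁻ (λ v → inN[] v c ≟B true) {xs = allWords n} v∈))
    ... | inj₁ refl       = h zero
    ... | inj₂ (i , refl) = h (suc i)

  inI⇒near : ∀ {u x} → inI C u x ≡ true → ∃ λ i → x ≡ near u i × C (near u i) ≡ true
  inI⇒near {u} {x} h with Cx , p ← ∧-true {C x} h with inN[]⇒flip {u = x} {u} p
  ... | inj₁ refl       = zero , refl , Cx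
  ... | inj₂ (i , refl) = suc i , refl , Cx

  inI⇒C : ∀ {u x} → inI C u x ≡ true → C x ≡ true
  inI⇒C {x = x} h = proj₁ (∧-true {C x} h)

  inI-self : ∀ {u} → C u ≡ true → inI C u u ≡ true
  inI-self {u} Cu = ∧-intro Cu (inN[]-refl u)

  inI-flip : ∀ {u} i → C (flip u i) ≡ true → inI C u (flip u i) ≡ true
  inI-flip {u} i h = ∧-intro h (inN[]-flip u i)

  inI-unflip : ∀ {u} i → C u ≡ true → inI C (flip u i) u ≡ true
  inI-unflip {u} i Cu = subst (λ x → inI C (flip u i) x ≡ true) (flip-flip u i)
    (inI-flip i (trans (cong C (flip-flip u i)) Cu))

  two≤cardI : ∀ {u a b} → inI C u a ≡ true → inI C u b ≡ true → b ≢ a → 2 ≤ K u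
  two≤cardI {u} a∈ b∈ b≢a
    with i , refl , Ca ← inI⇒near a∈ | j , refl , Cb ← inI⇒near b∈ = begin
      2                                      ≡⟨ cong₂ (λ x y → ⟦ x ⟧ + ⟦ y ⟧) Ca Cb ⟨
      ⟦ C (near u i) ⟧ + ⟦ C (near u j) ⟧    ≤⟨ two-terms≤sum (λ i → ⟦ C (near u i) ⟧) {i} {j} (b≢a ∘ cong (near u)) ⟩
      sum (λ i → ⟦ C (near u i) ⟧)           ≡⟨ cardI-near u ⟨
      K u                                    ∎
    where open ℕ.≤-Reasoning

  three≤cardI : ∀ {u a b x} → inI C u a ≡ true → inI C u b ≡ true → inI C u x ≡ true →
                b ≢ a → x ≢ a → x ≢ b → 3 ≤ K u
  three≤cardI {u} a∈ b∈ x∈ b≢a x≢a x≢b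
    with i , refl , Ca ← inI⇒near a∈ | j , refl , Cb ← inI⇒near b∈ | k , refl , Cx ← inI⇒near x∈ = begin
      3                                                              ≡⟨ cong₂ (λ x y → ⟦ x ⟧ + (⟦ y ⟧ + 1)) Ca Cb ⟨
      ⟦ C (near u i) ⟧ + (⟦ C (near u j) ⟧ + 1)                      ≡⟨ cong (λ x → ⟦ C (near u i) ⟧ + (⟦ C (near u j) ⟧ + ⟦ x ⟧)) Cx ⟨
      ⟦ C (near u i) ⟧ + (⟦ C (near u j) ⟧ + ⟦ C (near u k) ⟧)
        ≤⟨ three-terms≤sum (λ i → ⟦ C (near u i) ⟧) {i} {j} {k} (b≢a ∘ cong (near u)) (x≢a ∘ cong (near u)) (x≢b ∘ cong (near u)) ⟩
      sum (λ i → ⟦ C (near u i) ⟧)                                   ≡⟨ cardI-near u ⟨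
      K u                                                            ∎
    where open ℕ.≤-Reasoning

  I-singleton : ∀ {u a x} → K u ≡ 1 → inI C u a ≡ true → inI C u x ≡ true → x ≡ a
  I-singleton {a = a} {x} K1 a∈ x∈ with ≡-dec _≟B_ x a
  ... | yes x≡a = x≡a
  ... | no  x≢a = contradiction (subst (2 ≤_) K1 (two≤cardI a∈ x∈ x≢a)) λ { (s≤s ()) }

  I-pair : ∀ {u a b x} → K u ≡ 2 → inI C u a ≡ true → inI C u b ≡ true → b ≢ a →
           inI C u x ≡ true → x ≡ a ⊎ x ≡ b
  I-pair {a = a} {b} {x} K2 a∈ b∈ b≢a x∈ with ≡-dec _≟B_ x a | ≡-dec _≟B_ x b
  ... | yes x≡a | _       = inj₁ x≡a
  ... | no  _   | yes x≡b = inj₂ x≡b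
  ... | no  x≢a | no  x≢b = contradiction (subst (3 ≤_) K2 (three≤cardI a∈ b∈ x∈ b≢a x≢a x≢b)) λ { (s≤s (s≤s ())) }

  -- Locating-dominating codes and the graph of an isolated codeword

  module LocatingDominating (ld : IsLocatingDominating C) where

    dominating : ∀ u → 1 ≤ K u
    dominating = proj₁ (proj₂ ld)

    locating : ∀ {u v} → C u ≡ false → C v ≡ false → u ≢ v →
               (∀ x → inI C u x ≡ true → inI C v x ≡ true) → (∀ x → inI C v x ≡ true → inI C u x ≡ true) → ⊥
    locating Cu Cv u≢v f g = proj₂ (proj₂ ld) _ _ Cu Cv u≢v λ x → ⇔⇒≡ (f x) (g x)

    module _ {c : Word n} (Cc : C c ≡ true) where

      cardI≡1⇒noncode : ∀ {i} → K (flip c i) ≡ 1 → C (flip c i) ≡ false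
      cardI≡1⇒noncode {i} k1 = ¬-not λ Cx → flip≢ c i (I-singleton k1 (inI-unflip i Cc) (inI-self Cx))

      -- Both words would be non-codewords with I-set {c}, and locating-dominance separates distinct
      -- non-codewords.
      orphan-unique : ∀ {i j} → K (flip c i) ≡ 1 → K (flip c j) ≡ 1 → i ≡ j
      orphan-unique {i} {j} ki kj with i ≟F j
      ... | yes i≡j = i≡j
      ... | no  i≢j = ⊥-elim (locating (cardI≡1⇒noncode ki) (cardI≡1⇒noncode kj) (i≢j ∘ flip-injective c)
        (λ x x∈ → subst (λ y → inI C (flip c j) y ≡ true) (sym (I-singleton ki (inI-unflip i Cc) x∈)) (inI-unflip j Cc))
        (λ x x∈ → subst (λ y → inI C (flip c i) y ≡ true) (sym (I-singleton kj (inI-unflip j Cc) x∈)) (inI-unflip i Cc)))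

      orphans≤1 : sum (λ i → ⟦ K (flip c i) ≡ᵇ 1 ⟧) ≤ 1
      orphans≤1 = sum-⟦⟧≤1 _ λ p q → orphan-unique (≡ᵇ-true⁻ p) (≡ᵇ-true⁻ q)

    -- The codewords at distance two from an isolated codeword c are the edges of a graph on the
    -- n coordinates; the degree of i is k i − 1, and by locating-dominance this graph has at most
    -- one isolated vertex and no component consisting of a single edge.
    module Isolated {c : Word n} (Cc : C c ≡ true) (Kc : K c ≡ 1) where

      k : Fin n → ℕ
      k i = K (flip c i)

      orphans sons fathers : ℕ
      orphans = sum (λ i → ⟦ k i ≡ᵇ 1 ⟧)
      sons    = sum (λ i → ⟦ k i ≡ᵇ 2 ⟧)
      fathers = sum (λ i → ⟦ 3 ≤ᵇ k i ⟧)

      edge : Fin n → Fin n → Word n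
      edge i j = flip (flip c i) j

      noncode : ∀ i → C (flip c i) ≡ false
      noncode i = ¬-not λ Cx → flip≢ c i (I-singleton Kc (inI-self Cc) (inI-flip i Cx))

      edge≢c : ∀ {i j} → i ≢ j → edge i j ≢ c
      edge≢c {i} {j} i≢j eq = i≢j (sym (flip-injective (flip c i) (trans eq (sym (flip-flip c i)))))

      edge∈ˡ : ∀ {i j} → C (edge i j) ≡ true → inI C (flip c i) (edge i j) ≡ true
      edge∈ˡ {i} {j} = inI-flip j

      edge∈ʳ : ∀ {i j} → C (edge i j) ≡ true → inI C (flip c j) (edge i j) ≡ true
      edge∈ʳ {i} {j} h = subst (λ x → inI C (flip c j) x ≡ true) (flip-comm c j i)
        (inI-flip i (trans (cong C (flip-comm c j i)) h))

      edge⇒2≤k : ∀ {i j} → i ≢ j → C (edge i j) ≡ true → 2 ≤ k i × 2 ≤ k j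
      edge⇒2≤k {i} {j} i≢j e = two≤cardI (inI-unflip i Cc) (edge∈ˡ e) (edge≢c i≢j)
                             , two≤cardI (inI-unflip j Cc) (edge∈ʳ e) (edge≢c i≢j)

      -- With k i = 2 the I-set of c + i consists of `c` and `edge i j`, and both of these are
      -- within distance one of c + j.
      son-I : ∀ {i j y} → i ≢ j → C (edge i j) ≡ true → k i ≡ 2 →
              inI C (flip c i) y ≡ true → inI C (flip c j) y ≡ true
      son-I {i} {j} i≢j e ki y∈ with I-pair ki (inI-unflip i Cc) (edge∈ˡ e) (edge≢c i≢j) y∈
      ... | inj₁ refl = inI-unflip j Cc
      ... | inj₂ refl = edge∈ʳ e

      -- By `son-I` in both directions, the two non-codewords c + i and c + j would have the same
      -- I-set.
      no-isolated-edge : ∀ {i j} → i ≢ j → C (edge i j) ≡ true → k i ≡ 2 → k j ≡ 2 → ⊥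
      no-isolated-edge {i} {j} i≢j e ki kj = locating (noncode i) (noncode j) (i≢j ∘ flip-injective c)
        (λ y → son-I i≢j e ki)
        (λ y → son-I (i≢j ∘ sym) (trans (cong C (flip-comm c j i)) e) kj)

      edge⇒father : ∀ {i j} → i ≢ j → C (edge i j) ≡ true → 3 ≤ k i ⊎ 3 ≤ k j
      edge⇒father {i} {j} i≢j e with edge⇒2≤k i≢j e
      ... | pi , pj with ℕ.m≤n⇒m<n∨m≡n pi | ℕ.m≤n⇒m<n∨m≡n pj
      ... | inj₁ q | _      = inj₁ q
      ... | inj₂ _ | inj₁ q = inj₂ q
      ... | inj₂ p | inj₂ q = ⊥-elim (no-isolated-edge i≢j e (sym p) (sym q))

      -- The diagonal word `edge i i` is `c` itself and supplies the successor; the remaining sum is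
      -- the degree of `i` in the graph.
      k-split : ∀ i → k i ≡ suc (sum (avoiding i (λ j → ⟦ C (edge i j) ⟧)))
      k-split i = begin
        k i                                             ≡⟨ cardI-flip (noncode i) ⟩
        sum (λ j → ⟦ C (edge i j) ⟧)                    ≡⟨ sum-avoiding i _ ⟩
        ⟦ C (edge i i) ⟧ + sum (avoiding i _)           ≡⟨ cong (λ b → ⟦ b ⟧ + sum (avoiding i (λ j → ⟦ C (edge i j) ⟧))) (trans (cong C (flip-flip c i)) Cc) ⟩
        suc (sum (avoiding i (λ j → ⟦ C (edge i j) ⟧))) ∎
        where open ≡-Reasoning

      son⇒father : ∀ {i} → k i ≡ 2 → ∃ λ j → i ≢ j × C (edge i j) ≡ true × 3 ≤ k j
      son⇒father {i} ki
        with j , p ← positive-term (avoiding i (λ j → ⟦ C (edge i j) ⟧))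
                       (ℕ.≤-reflexive (sym (ℕ.suc-injective (trans (sym (k-split i)) ki))))
        with i ≟F j
      ... | yes refl with () ← ℕ.≤-trans p (ℕ.≤-reflexive (avoiding-0 i (λ j → ⟦ C (edge i j) ⟧)))
      ... | no  i≢j  with e ← 1≤⟦⟧⇒true (subst (1 ≤_) (avoiding-≢ (λ j → ⟦ C (edge i j) ⟧) (i≢j ∘ sym)) p)
                     with edge⇒father i≢j e
      ...   | inj₂ q = j , i≢j , e , q
      ...   | inj₁ q = contradiction (subst (3 ≤_) ki q) λ { (s≤s (s≤s ())) }

      -- The father demanded by `isSon` always exists: it is the other end of the only edge at `i`,
      -- and `son-I` gives the inclusion of I-sets.
      isSon≡ : ∀ i → isSon C (flip c i) ≡ (k i ≡ᵇ 2)
      isSon≡ i = ⇔⇒≡ (proj₁ ∘ ∧-true) λ p → ∧-intro p (son (≡ᵇ-true⁻ p))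
        where
        son : k i ≡ 2 → any (λ u → isFather C u ∧ subI C (flip c i) u) (allWords n) ≡ true
        son ki with j , i≢j , e , q ← son⇒father ki =
          any-true⁺ _ (∈-allWords (flip c j)) (∧-intro (≤ᵇ-true⁺ q)
            (all-true⁺ _ (allWords n) λ y → implication⁺ (son-I i≢j e ki)))

      isOrphan≡ : ∀ i → isOrphan C (flip c i) ≡ (k i ≡ᵇ 1)
      isOrphan≡ i = cong (λ b → not b ∧ (k i ≡ᵇ 1)) (noncode i)

      countOrphans : countN C (isOrphan C) c ≡ orphans
      countOrphans = trans (countN-flip _ c) (sum-cong-≗ (cong ⟦_⟧ ∘ isOrphan≡))

      countSons : countN C (isSon C) c ≡ sons
      countSons = trans (countN-flip _ c) (sum-cong-≗ (cong ⟦_⟧ ∘ isSon≡))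

      -- Domination rules out k i = 0, so the three classes partition the coordinates.
      orphans+sons+fathers : orphans + (sons + fathers) ≡ n
      orphans+sons+fathers = begin
        orphans + (sons + fathers)  ≡⟨ cong (orphans +_) (∑-distrib-+ (λ i → ⟦ k i ≡ᵇ 2 ⟧) _) ⟨
        orphans + sum (λ i → ⟦ k i ≡ᵇ 2 ⟧ + ⟦ 3 ≤ᵇ k i ⟧)  ≡⟨ ∑-distrib-+ (λ i → ⟦ k i ≡ᵇ 1 ⟧) _ ⟨
        sum (λ i → ⟦ k i ≡ᵇ 1 ⟧ + (⟦ k i ≡ᵇ 2 ⟧ + ⟦ 3 ≤ᵇ k i ⟧)) ≡⟨ sum-cong-≗ (λ i → classify (dominating (flip c i))) ⟩
        sum {n} (λ _ → 1)           ≡⟨ sum-const n 1 ⟩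
        n * 1                       ≡⟨ ℕ.*-identityʳ n ⟩
        n                           ∎
        where
        open ≡-Reasoning
        classify : ∀ {m} → 1 ≤ m → ⟦ m ≡ᵇ 1 ⟧ + (⟦ m ≡ᵇ 2 ⟧ + ⟦ 3 ≤ᵇ m ⟧) ≡ 1
        classify {1} _ = refl
        classify {2} _ = refl
        classify {suc (suc (suc m))} _ = refl

      -- Count the pairs (son, adjacent father).
      sons+fathers≤ : sons + fathers ≤ sum (λ j → ⟦ 3 ≤ᵇ k j ⟧ * k j)
      sons+fathers≤ = begin
        sons + fathers                                         ≤⟨ ℕ.+-monoˡ-≤ fathers (sum-mono son-degree) ⟩
        sum (λ i → sum (λ j → pair i j)) + fathers             ≡⟨ cong (_+ fathers) (∑-comm pair) ⟩
        sum (λ j → sum (λ i → pair i j)) + fathers             ≡⟨ ∑-distrib-+ (λ j → sum (λ i → pair i j)) _ ⟨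
        sum (λ j → sum (λ i → pair i j) + ⟦ 3 ≤ᵇ k j ⟧)        ≤⟨ sum-mono father-degree ⟩
        sum (λ j → ⟦ 3 ≤ᵇ k j ⟧ * k j)                         ∎
        where
        open ℕ.≤-Reasoning
        pair : Fin n → Fin n → ℕ
        pair i j = ⟦ (k i ≡ᵇ 2) ∧ (3 ≤ᵇ k j) ∧ C (edge i j) ⟧

        son-degree : ∀ i → ⟦ k i ≡ᵇ 2 ⟧ ≤ sum (pair i)
        son-degree i with k i ≡ᵇ 2 in eq
        ... | false = z≤n
        ... | true with j , i≢j , e , q ← son⇒father (≡ᵇ-true⁻ {k i} eq) =
          ℕ.≤-trans (ℕ.≤-reflexive (cong ⟦_⟧ (sym (∧-intro (≤ᵇ-true⁺ q) e))))
                    (term≤sum (λ j → ⟦ (3 ≤ᵇ k j) ∧ C (edge i j) ⟧) j)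

        -- On the diagonal `edge j j` is a codeword, but a father is not a son, so the pair (j, j)
        -- still counts 0.
        pair≤ : ∀ j → 3 ≤ k j → ∀ i → pair i j ≤ avoiding j (λ i → ⟦ C (edge j i) ⟧) i
        pair≤ j q i with i ≟F j
        ... | yes refl rewrite ¬-not {k i ≡ᵇ 2} (λ p → contradiction (subst (3 ≤_) (≡ᵇ-true⁻ {k i} p) q) λ { (s≤s (s≤s ())) }) = z≤n
        ... | no  _ rewrite flip-comm c j i = weaken (k i ≡ᵇ 2) (3 ≤ᵇ k j) _
          where
          weaken : ∀ a b x → ⟦ a ∧ b ∧ x ⟧ ≤ ⟦ x ⟧
          weaken true  true  x = ℕ.≤-refl
          weaken true  false x = z≤n
          weaken false b     x = z≤n

        -- A father has k j - 1 edges, hence at most k j - 1 adjacent sons; counting the father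
        -- itself as well gives k j.
        father-degree : ∀ j → sum (λ i → pair i j) + ⟦ 3 ≤ᵇ k j ⟧ ≤ ⟦ 3 ≤ᵇ k j ⟧ * k j
        father-degree j with 3 ≤ᵇ k j in eq
        ... | true  = begin
          sum son-edges + 1                                  ≡⟨ ℕ.+-comm _ 1 ⟩
          suc (sum son-edges)                                ≤⟨ s≤s (sum-mono son-edges≤) ⟩
          suc (sum (avoiding j (λ i → ⟦ C (edge j i) ⟧)))    ≡⟨ k-split j ⟨
          k j                                                ≡⟨ ℕ.+-identityʳ (k j) ⟨
          k j + 0                                            ∎
          where
          son-edges : Fin n → ℕ
          son-edges i = ⟦ (k i ≡ᵇ 2) ∧ true ∧ C (edge i j) ⟧
          son-edges≤ : ∀ i → son-edges i ≤ avoiding j (λ i → ⟦ C (edge j i) ⟧) i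
          son-edges≤ i = subst (λ b → ⟦ (k i ≡ᵇ 2) ∧ b ∧ C (edge i j) ⟧ ≤ avoiding j (λ i → ⟦ C (edge j i) ⟧) i)
                               eq (pair≤ j (≤ᵇ-true⁻ eq) i)
        ... | false = ℕ.≤-reflexive (trans (ℕ.+-identityʳ _) (trans (sum-cong-≗ vanish) (trans (sum-const n 0) (ℕ.*-zeroʳ n))))
          where
          vanish : ∀ i → ⟦ (k i ≡ᵇ 2) ∧ false ⟧ ≡ 0
          vanish i with k i ≡ᵇ 2
          ... | true  = refl
          ... | false = refl

-- Rule 1 as a recursion over a list of words

module _ {n : ℕ} (C : Code n) (c : Word n) where

  redistribute : List (Word n) → ℚ
  redistribute []       = share C c
  redistribute (u ∷ us) = if isSpecialFather C u ∧ inC' C u c then avgShare C u else redistribute us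

  -- shareAfter is defined by a local recursion that cannot be named here, so the statement of
  -- the lemma proved by induction is left to be inferred from its use.
  mutual
    shareAfter≡redistribute : shareAfter C c ≡ redistribute (allWords n)
    shareAfter≡redistribute with allWords n
    ... | us = go≡redistribute us

    go≡redistribute : (us : List (Word n)) → _
    go≡redistribute [] = refl
    go≡redistribute (u ∷ us) with isSpecialFather C u ∧ inC' C u c
    ... | true  = refl
    ... | false = go≡redistribute us

-- Integer weights for the reciprocals

-- Upper bounds for 18 / k.
w : ℕ → ℕ
w 0 = 0
w 1 = 18
w 2 = 9
w 3 = 6
w 4 = 5
w 5 = 4
w (suc (suc (suc (suc (suc (suc _)))))) = 3

w-bound : ∀ {k} → 1 ≤ k → 18 ≤ w k * k
w-bound {1} _ = ℕ.≤-refl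
w-bound {2} _ = ℕ.≤-refl
w-bound {3} _ = ℕ.≤-refl
w-bound {4} _ = ℕ.m≤m+n 18 2
w-bound {5} _ = ℕ.m≤m+n 18 2
w-bound {suc (suc (suc (suc (suc (suc m)))))} _ = ℕ.*-monoʳ-≤ 3 (ℕ.m≤m+n 6 m)

-- Measured against the weight 9 of a son, an orphan costs 9 more, a father saves at least 3, and a
-- father with k ≥ 6 saves 6.
w-≤ : ∀ k → w k + (3 * ⟦ 3 ≤ᵇ k ⟧ + 3 * ⟦ 6 ≤ᵇ k ⟧) ≤ 9 + 9 * ⟦ k ≡ᵇ 1 ⟧
w-≤ 0 = z≤n
w-≤ 1 = ℕ.≤-refl
w-≤ 2 = ℕ.≤-refl
w-≤ 3 = ℕ.≤-refl
w-≤ 4 = ℕ.m≤m+n 8 1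
w-≤ 5 = ℕ.m≤m+n 7 2
w-≤ (suc (suc (suc (suc (suc (suc m)))))) = ℕ.≤-refl

-- For k = 3, 4, 5 the rounded weights satisfy w k + k = 9. A lower bound on the sizes of the
-- fathers thus becomes an upper bound on their weights.
w-≤-small : ∀ k → k ≤ 5 → w k + ⟦ 3 ≤ᵇ k ⟧ * k ≤ 9 * ⟦ 3 ≤ᵇ k ⟧ + (9 * ⟦ k ≡ᵇ 2 ⟧ + 18 * ⟦ k ≡ᵇ 1 ⟧)
w-≤-small 0 _ = z≤n
w-≤-small 1 _ = ℕ.≤-refl
w-≤-small 2 _ = ℕ.≤-refl
w-≤-small 3 _ = ℕ.≤-refl
w-≤-small 4 _ = ℕ.≤-refl
w-≤-small 5 _ = ℕ.≤-refl
w-≤-small (suc (suc (suc (suc (suc (suc m)))))) (s≤s (s≤s (s≤s (s≤s (s≤s ())))))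

w-≤9 : ∀ {k} → 2 ≤ k → w k ≤ 9
w-≤9 {k} 2≤k = ℕ.≤-trans (ℕ.m≤m+n (w k) _) (ℕ.≤-trans (w-≤ k) (ℕ.≤-reflexive (cong (λ b → 9 + 9 * ⟦ b ⟧) (k≢1 2≤k))))
  where
  k≢1 : ∀ {k} → 2 ≤ k → (k ≡ᵇ 1) ≡ false
  k≢1 (s≤s (s≤s _)) = refl

sum-linear : ∀ {n} a b (f g : Fin n → ℕ) → sum (λ i → a * f i + b * g i) ≡ a * sum f + b * sum g
sum-linear a b f g = trans (∑-distrib-+ (λ i → a * f i) _) (cong₂ _+_ (sym (*-distribˡ-sum a f)) (sym (*-distribˡ-sum b g)))

sum-w-≤ : ∀ {n} (k : Fin n → ℕ) →
  sum (w ∘ k) + (3 * sum (λ i → ⟦ 3 ≤ᵇ k i ⟧) + 3 * sum (λ i → ⟦ 6 ≤ᵇ k i ⟧)) ≤ n * 9 + 9 * sum (λ i → ⟦ k i ≡ᵇ 1 ⟧)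
sum-w-≤ {n} k = begin
  sum (w ∘ k) + (3 * sum (λ i → ⟦ 3 ≤ᵇ k i ⟧) + 3 * sum (λ i → ⟦ 6 ≤ᵇ k i ⟧))
    ≡⟨ cong (sum (w ∘ k) +_) (sum-linear 3 3 (λ i → ⟦ 3 ≤ᵇ k i ⟧) (λ i → ⟦ 6 ≤ᵇ k i ⟧)) ⟨
  sum (w ∘ k) + sum (λ i → 3 * ⟦ 3 ≤ᵇ k i ⟧ + 3 * ⟦ 6 ≤ᵇ k i ⟧)
    ≡⟨ ∑-distrib-+ (w ∘ k) _ ⟨
  sum (λ i → w (k i) + (3 * ⟦ 3 ≤ᵇ k i ⟧ + 3 * ⟦ 6 ≤ᵇ k i ⟧))
    ≤⟨ sum-mono (w-≤ ∘ k) ⟩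
  sum (λ i → 9 + 9 * ⟦ k i ≡ᵇ 1 ⟧)
    ≡⟨ ∑-distrib-+ (λ _ → 9) (λ i → 9 * ⟦ k i ≡ᵇ 1 ⟧) ⟩
  sum {n} (λ _ → 9) + sum (λ i → 9 * ⟦ k i ≡ᵇ 1 ⟧)
    ≡⟨ cong₂ _+_ (sum-const n 9) (sym (*-distribˡ-sum 9 (λ i → ⟦ k i ≡ᵇ 1 ⟧))) ⟩
  n * 9 + 9 * sum (λ i → ⟦ k i ≡ᵇ 1 ⟧) ∎
  where open ℕ.≤-Reasoning

sum-w-≤-small : ∀ {n} (k : Fin n → ℕ) → (∀ i → k i ≤ 5) →
  sum (w ∘ k) + sum (λ i → ⟦ 3 ≤ᵇ k i ⟧ * k i) ≤
  9 * sum (λ i → ⟦ 3 ≤ᵇ k i ⟧) + (9 * sum (λ i → ⟦ k i ≡ᵇ 2 ⟧) + 18 * sum (λ i → ⟦ k i ≡ᵇ 1 ⟧))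
sum-w-≤-small k small = begin
  sum (w ∘ k) + sum (λ i → ⟦ 3 ≤ᵇ k i ⟧ * k i)
    ≡⟨ ∑-distrib-+ (w ∘ k) _ ⟨
  sum (λ i → w (k i) + ⟦ 3 ≤ᵇ k i ⟧ * k i)
    ≤⟨ sum-mono (λ i → w-≤-small (k i) (small i)) ⟩
  sum (λ i → 9 * ⟦ 3 ≤ᵇ k i ⟧ + (9 * ⟦ k i ≡ᵇ 2 ⟧ + 18 * ⟦ k i ≡ᵇ 1 ⟧))
    ≡⟨ ∑-distrib-+ (λ i → 9 * ⟦ 3 ≤ᵇ k i ⟧) _ ⟩
  sum (λ i → 9 * ⟦ 3 ≤ᵇ k i ⟧) + sum (λ i → 9 * ⟦ k i ≡ᵇ 2 ⟧ + 18 * ⟦ k i ≡ᵇ 1 ⟧)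
    ≡⟨ cong₂ _+_ (sym (*-distribˡ-sum 9 (λ i → ⟦ 3 ≤ᵇ k i ⟧))) (sum-linear 9 18 (λ i → ⟦ k i ≡ᵇ 2 ⟧) (λ i → ⟦ k i ≡ᵇ 1 ⟧)) ⟩
  9 * sum (λ i → ⟦ 3 ≤ᵇ k i ⟧) + (9 * sum (λ i → ⟦ k i ≡ᵇ 2 ⟧) + 18 * sum (λ i → ⟦ k i ≡ᵇ 1 ⟧)) ∎
  where open ℕ.≤-Reasoning

term≡0 : ∀ {n} (p : Fin n → Bool) → sum (⟦_⟧ ∘ p) ≡ 0 → ∀ i → p i ≡ false
term≡0 p eq i = ¬-not λ pi → contradiction (subst (1 ≤_) eq (ℕ.≤-trans (ℕ.≤-reflexive (cong ⟦_⟧ (sym pi))) (term≤sum (⟦_⟧ ∘ p) i))) λ ()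

-- Codewords that are not special

-- All shares are compared over the common denominator 1 + d = 18 N, where N = n − 1.
module _ {N n d : ℕ} (9≤N : 9 ≤ N) (n≡1+N : n ≡ suc N) (1+d≡18N : suc d ≡ 18 * N) (C : Code n) (ld : IsLocatingDominating C) where

  open LocatingDominating C ld

  private
    K = cardI C

    -- Over the denominator 18 N this is (n + 2) / 2, the bound of the theorem.
    target : ℕ
    target = N * (9 * (n + 2))

  10≤n : 10 ≤ n
  10≤n = subst (10 ≤_) (sym n≡1+N) (s≤s 9≤N)

  target≤ : target // d ℚ.≤ (n + 2) // 1
  target≤ = //-≤ {target} {d} {n + 2} {1} (ℕ.≤-reflexive (trans (identity N (n + 2)) (cong ((n + 2) *_) (sym 1+d≡18N))))
    where
    identity : ∀ N m → N * (9 * m) * 2 ≡ m * (18 * N)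
    identity = solve-∀

  -- Only an orphan weighs more than 9, and there is at most one, so the fathers have to save 9.
  -- Three fathers save 3 each; two save 9 if one has k ≥ 6, and otherwise by the degree count. One
  -- father would make `c` special, and without fathers there are no sons, leaving n = 1.
  nonspecial-isolated : ∀ {c} → C c ≡ true → K c ≡ 1 → isSpecial C c ≡ false →
                        sum (λ i → w (K (flip c i))) ≤ n * 9
  nonspecial-isolated {c} Cc Kc ns = by-counts orphans fathers refl refl
    where
    open Isolated Cc Kc
    open ℕ.≤-Reasoning
    σ = sum (w ∘ k)
    E = sum (λ i → ⟦ 6 ≤ᵇ k i ⟧)

    special : orphans ≡ 1 → fathers ≡ 1 → isSpecial C c ≡ true
    special z b = ∧-intro Cc (∧-intro (≡ᵇ-true⁺ Kc) (∧-intro (≡ᵇ-true⁺ (trans countOrphans z))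
      (≡ᵇ-true⁺ (trans countSons sons≡))))
      where
      sons≡ : sons ≡ n ℕ.∸ 2
      sons≡ = trans (sym (ℕ.m+n∸n≡m sons 1)) (cong (ℕ._∸ 2)
        (trans (cong₂ (λ x y → x + (sons + y)) (sym z) (sym b)) orphans+sons+fathers))

    no-fathers : fathers ≡ 0 → sons ≡ 0
    no-fathers b = ℕ.n≤0⇒n≡0 (begin
      sons                              ≤⟨ ℕ.m≤m+n sons fathers ⟩
      sons + fathers                    ≤⟨ sons+fathers≤ ⟩
      sum (λ j → ⟦ 3 ≤ᵇ k j ⟧ * k j)    ≡⟨ sum-cong-≗ (λ j → cong (λ b → ⟦ b ⟧ * k j) (term≡0 (λ j → 3 ≤ᵇ k j) b j)) ⟩
      sum {n} (λ _ → 0)                 ≡⟨ trans (sum-const n 0) (ℕ.*-zeroʳ n) ⟩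
      0                                 ∎)

    two-fathers : orphans ≡ 1 → fathers ≡ 2 → ∀ e → E ≡ e → σ ≤ n * 9
    two-fathers z b (suc e) E≡ = ℕ.+-cancelʳ-≤ 9 σ (n * 9) (begin
      σ + (3 * 2 + 3 * 1)          ≤⟨ ℕ.+-monoʳ-≤ σ (ℕ.+-mono-≤ (ℕ.≤-reflexive (cong (3 *_) (sym b)))
                                       (ℕ.*-monoʳ-≤ 3 (subst (1 ≤_) (sym E≡) (s≤s z≤n)))) ⟩
      σ + (3 * fathers + 3 * E)    ≤⟨ sum-w-≤ k ⟩
      n * 9 + 9 * orphans          ≡⟨ cong (λ x → n * 9 + 9 * x) z ⟩
      n * 9 + 9                    ∎)
    -- Both fathers have k ≤ 5, where w k = 9 - k. Their sizes add up to at least `sons + fathers`,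
    -- which is n - 1 ≥ 9, so together they weigh at most 9.
    two-fathers z b zero E≡ = ℕ.+-cancelʳ-≤ 9 σ (n * 9) (begin
      σ + 9                                  ≤⟨ ℕ.+-monoʳ-≤ σ (ℕ.s≤s⁻¹ (subst (10 ≤_) n≡ 10≤n)) ⟩
      σ + (sons + 2)                         ≡⟨ cong (λ x → σ + (sons + x)) b ⟨
      σ + (sons + fathers)                   ≤⟨ ℕ.+-monoʳ-≤ σ sons+fathers≤ ⟩
      σ + sum (λ j → ⟦ 3 ≤ᵇ k j ⟧ * k j)     ≤⟨ sum-w-≤-small k small ⟩
      9 * fathers + (9 * sons + 18 * orphans) ≡⟨ cong₂ (λ x y → 9 * x + (9 * sons + 18 * y)) b z ⟩
      9 * 2 + (9 * sons + 18 * 1)            ≡⟨ identity sons ⟩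
      suc (sons + 2) * 9 + 9                 ≡⟨ cong (λ x → x * 9 + 9) n≡ ⟨
      n * 9 + 9                              ∎)
      where
      n≡ : n ≡ suc (sons + 2)
      n≡ = trans (sym orphans+sons+fathers) (cong₂ (λ x y → x + (sons + y)) z b)
      small : ∀ i → k i ≤ 5
      small i = ℕ.≮⇒≥ λ 6≤k → true≢false (≤ᵇ-true⁺ 6≤k) (term≡0 (λ i → 6 ≤ᵇ k i) E≡ i)
      identity : ∀ s → 9 * 2 + (9 * s + 18 * 1) ≡ suc (s + 2) * 9 + 9
      identity = solve-∀

    by-counts : ∀ z b → orphans ≡ z → fathers ≡ b → σ ≤ n * 9
    by-counts 0 b z≡ b≡ = begin
      σ                         ≤⟨ ℕ.m≤m+n σ _ ⟩
      σ + (3 * fathers + 3 * E) ≤⟨ sum-w-≤ k ⟩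
      n * 9 + 9 * orphans       ≡⟨ cong (λ x → n * 9 + 9 * x) z≡ ⟩
      n * 9 + 0                 ≡⟨ ℕ.+-identityʳ _ ⟩
      n * 9                     ∎
    by-counts (suc (suc z)) b z≡ b≡ with s≤s () ← subst (_≤ 1) z≡ (orphans≤1 Cc)
    by-counts 1 0 z≡ b≡ = contradiction (subst (10 ≤_) (trans (sym orphans+sons+fathers)
      (trans (cong₂ (λ x y → x + (sons + y)) z≡ b≡) (cong (λ x → suc (x + 0)) (no-fathers b≡)))) 10≤n) λ { (s≤s ()) }
    by-counts 1 1 z≡ b≡ = ⊥-elim (true≢false (special z≡ b≡) ns)
    by-counts 1 2 z≡ b≡ = two-fathers z≡ b≡ E refl
    by-counts 1 (suc (suc (suc b))) z≡ b≡ = ℕ.+-cancelʳ-≤ 9 σ (n * 9) (begin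
      σ + 3 * 3                    ≤⟨ ℕ.+-monoʳ-≤ σ (ℕ.*-monoʳ-≤ 3 (subst (3 ≤_) (sym b≡) (ℕ.m≤m+n 3 b))) ⟩
      σ + 3 * fathers              ≤⟨ ℕ.+-monoʳ-≤ σ (ℕ.m≤m+n _ _) ⟩
      σ + (3 * fathers + 3 * E)    ≤⟨ sum-w-≤ k ⟩
      n * 9 + 9 * orphans          ≡⟨ cong (λ x → n * 9 + 9 * x) z≡ ⟩
      n * 9 + 9                    ∎)

  -- The budget is 18 + 9 n. An isolated codeword uses the 18 itself; any other weighs at most 9 and
  -- leaves 9 for the surplus of a possible orphan.
  nonspecial-weight : ∀ {c} → C c ≡ true → isSpecial C c ≡ false → sum (λ i → w (K (near c i))) ≤ 9 * (n + 2)
  nonspecial-weight {c} Cc ns with ℕ.m≤n⇒m<n∨m≡n (dominating c)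
  ... | inj₂ 1≡K = begin
    w (K c) + sum (λ i → w (K (flip c i)))  ≤⟨ ℕ.+-mono-≤ (ℕ.≤-reflexive (cong w (sym 1≡K))) (nonspecial-isolated Cc (sym 1≡K) ns) ⟩
    18 + n * 9                              ≡⟨ identity n ⟩
    9 * (n + 2)                             ∎
    where
    open ℕ.≤-Reasoning
    identity : ∀ n → 18 + n * 9 ≡ 9 * (n + 2)
    identity = solve-∀
  ... | inj₁ 2≤K = begin
    w (K c) + sum (λ i → w (K (flip c i)))  ≤⟨ ℕ.+-mono-≤ (w-≤9 2≤K) (ℕ.≤-trans (ℕ.m≤m+n _ _) (sum-w-≤ (λ i → K (flip c i)))) ⟩
    9 + (n * 9 + 9 * sum (λ i → ⟦ K (flip c i) ≡ᵇ 1 ⟧))  ≤⟨ ℕ.+-monoʳ-≤ 9 (ℕ.+-monoʳ-≤ (n * 9) (ℕ.*-monoʳ-≤ 9 (orphans≤1 Cc))) ⟩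
    9 + (n * 9 + 9)                         ≡⟨ identity n ⟩
    9 * (n + 2)                             ∎
    where
    open ℕ.≤-Reasoning
    identity : ∀ n → 9 + (n * 9 + 9) ≡ 9 * (n + 2)
    identity = solve-∀

  nonspecial-share : ∀ {c} → C c ≡ true → isSpecial C c ≡ false → share C c ℚ.≤ target // d
  nonspecial-share {c} Cc ns = share-≤ C (λ k → N * w k) c scaled (begin
      sum (λ i → N * w (K (near c i)))  ≡⟨ *-distribˡ-sum N (λ i → w (K (near c i))) ⟨
      N * sum (λ i → w (K (near c i)))  ≤⟨ ℕ.*-monoʳ-≤ N (nonspecial-weight Cc ns) ⟩
      target                            ∎)
    where
    open ℕ.≤-Reasoning
    scaled : ∀ i → suc d ≤ N * w (K (near c i)) * K (near c i)
    scaled i = begin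
      suc d                                   ≡⟨ trans 1+d≡18N (ℕ.*-comm 18 N) ⟩
      N * 18                                  ≤⟨ ℕ.*-monoʳ-≤ N (w-bound (dominating (near c i))) ⟩
      N * (w (K (near c i)) * K (near c i))   ≡⟨ ℕ.*-assoc N _ _ ⟨
      N * w (K (near c i)) * K (near c i)     ∎

  -- Special codewords

  -- Upper bounds for 18 N / k.
  ω : ℕ → ℕ
  ω k = if k ≡ᵇ 1 then 18 * N else if N ≤ᵇ k then 18 else 9 * N

  18≤9N : 18 ≤ 9 * N
  18≤9N = ℕ.*-monoʳ-≤ 9 (ℕ.≤-trans (s≤s (s≤s z≤n)) 9≤N)

  ω-large : ∀ {k} → N ≤ k → ω k ≡ 18
  ω-large {k} N≤k with k ≡ᵇ 1 in eq
  ... | true  = contradiction (ℕ.≤-trans 9≤N (subst (N ≤_) (≡ᵇ-true⁻ {k} eq) N≤k)) λ { (s≤s ()) }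
  ... | false rewrite ≤ᵇ-true⁺ N≤k = refl

  ω-≤ : ∀ {k} → 2 ≤ k → ω k ≤ 9 * N
  ω-≤ {suc (suc k)} _ with N ≤ᵇ suc (suc k)
  ... | true  = 18≤9N
  ... | false = ℕ.≤-refl
  ω-≤ {suc zero} (s≤s ())

  ω-bound : ∀ {k} → 1 ≤ k → 18 * N ≤ ω k * k
  ω-bound {1} _ = ℕ.≤-reflexive (sym (ℕ.*-identityʳ (18 * N)))
  ω-bound {suc (suc k)} _ with N ≤ᵇ suc (suc k) in eq
  ... | true  = ℕ.*-monoʳ-≤ 18 (≤ᵇ-true⁻ {N} eq)
  ... | false = ℕ.≤-trans (ℕ.≤-reflexive (identity N)) (ℕ.*-monoʳ-≤ (9 * N) (s≤s (s≤s (z≤n {k}))))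
    where
    identity : ∀ N → 18 * N ≡ 9 * N * 2
    identity = solve-∀

  share-ω : ∀ {c M} → sum (λ i → ω (K (near c i))) ≤ M → share C c ℚ.≤ M // d
  share-ω {c} = share-≤ C ω c λ i → ℕ.≤-trans (ℕ.≤-reflexive 1+d≡18N) (ω-bound (dominating (near c i)))

  -- The counts in `isSpecial` turned into coordinates: `f` points to the only father next to `c`,
  -- and `o` to an orphan.
  record Special (c : Word n) : Set where
    field
      Cc     : C c ≡ true
      Kc     : K c ≡ 1
      f      : Fin n
      N≤Kf   : N ≤ K (flip c f)
      f-only : ∀ {i} → 3 ≤ K (flip c i) → i ≡ f
      o      : Fin n
      Ko     : K (flip c o) ≡ 1

    open Isolated Cc Kc public

    3≤Kf : 3 ≤ K (flip c f)
    3≤Kf = ℕ.≤-trans (ℕ.≤-trans (ℕ.m≤m+n 3 6) 9≤N) N≤Kf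

    f≢o : f ≢ o
    f≢o f≡o = contradiction (subst (λ i → 3 ≤ K (flip c i)) f≡o 3≤Kf) λ 3≤Ko → contradiction (subst (3 ≤_) Ko 3≤Ko) λ { (s≤s ()) }

    edge⇒f : ∀ {i j} → i ≢ j → C (edge i j) ≡ true → i ≡ f ⊎ j ≡ f
    edge⇒f i≢j e with edge⇒father i≢j e
    ... | inj₁ p = inj₁ (f-only p)
    ... | inj₂ p = inj₂ (f-only p)

    one-father : fathers ≡ 1
    one-father = ℕ.≤-antisym
      (sum-⟦⟧≤1 _ λ {i} {j} p q → trans (f-only (≤ᵇ-true⁻ {3} {k i} p)) (sym (f-only (≤ᵇ-true⁻ {3} {k j} q))))
      (ℕ.≤-trans (ℕ.≤-reflexive (cong ⟦_⟧ (sym (≤ᵇ-true⁺ 3≤Kf)))) (term≤sum (λ i → ⟦ 3 ≤ᵇ k i ⟧) f))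

  -- One orphan and n - 2 sons leave exactly one father. By `sons+fathers≤` its size is at least (n
  -- - 2) + 1 = N.
  special⁻ : ∀ {c} → isSpecial C c ≡ true → Special c
  special⁻ {c} h
    with Cc , h₁ ← ∧-true {C c} h
    with K1 , h₂ ← ∧-true {K c ≡ᵇ 1} h₁
    with co , cs ← ∧-true {countN C (isOrphan C) c ≡ᵇ 1} h₂
    = record { Cc = Cc ; Kc = Kc ; f = f ; N≤Kf = N≤Kf ; f-only = λ p → f-only (≤ᵇ-true⁺ p)
             ; o = proj₁ orphan ; Ko = ≡ᵇ-true⁻ (1≤⟦⟧⇒true (proj₂ orphan)) }
    where
    open ℕ.≤-Reasoning
    Kc : K c ≡ 1
    Kc = ≡ᵇ-true⁻ K1
    open Isolated Cc Kc
    orphans≡ : orphans ≡ 1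
    orphans≡ = trans (sym countOrphans) (≡ᵇ-true⁻ co)
    sons≡ : sons ≡ n ℕ.∸ 2
    sons≡ = trans (sym countSons) (≡ᵇ-true⁻ cs)
    sons+fathers≡ : sons + fathers ≡ N
    sons+fathers≡ = ℕ.suc-injective (trans (cong (_+ (sons + fathers)) (sym orphans≡)) (trans orphans+sons+fathers n≡1+N))
    sons+1≡ : sons + 1 ≡ N
    sons+1≡ = trans (cong (_+ 1) (trans sons≡ (cong (ℕ._∸ 2) n≡1+N))) (ℕ.m∸n+n≡m (ℕ.≤-trans (s≤s z≤n) 9≤N))
    orphan : ∃ λ i → 1 ≤ ⟦ k i ≡ᵇ 1 ⟧
    orphan = positive-term _ (ℕ.≤-reflexive (sym orphans≡))
    fathers≡ : fathers ≡ 1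
    fathers≡ = ℕ.+-cancelˡ-≡ sons fathers 1 (trans sons+fathers≡ (sym sons+1≡))
    father : ∃ λ i → 1 ≤ ⟦ 3 ≤ᵇ k i ⟧
    father = positive-term _ (ℕ.≤-reflexive (sym fathers≡))
    f = proj₁ father
    f-only : ∀ {i} → (3 ≤ᵇ k i) ≡ true → i ≡ f
    f-only p = sum-⟦⟧≤1⁻ (λ i → 3 ≤ᵇ k i) (ℕ.≤-reflexive fathers≡) p (1≤⟦⟧⇒true (proj₂ father))
    only-f : ∀ j → ⟦ 3 ≤ᵇ k j ⟧ * k j ≤ ⟦ 3 ≤ᵇ k j ⟧ * k f
    only-f j with 3 ≤ᵇ k j in eq
    ... | false = z≤n
    ... | true  = ℕ.≤-reflexive (cong (λ i → k i + 0) (f-only eq))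
    N≤Kf : N ≤ k f
    N≤Kf = begin
      N                                  ≡⟨ sons+fathers≡ ⟨
      sons + fathers                     ≤⟨ sons+fathers≤ ⟩
      sum (λ j → ⟦ 3 ≤ᵇ k j ⟧ * k j)     ≤⟨ sum-mono only-f ⟩
      sum (λ j → ⟦ 3 ≤ᵇ k j ⟧ * k f)     ≡⟨ *-distribʳ-sum (k f) (λ j → ⟦ 3 ≤ᵇ k j ⟧) ⟨
      fathers * k f                      ≡⟨ cong (_* k f) fathers≡ ⟩
      1 * k f                            ≡⟨ ℕ.*-identityˡ (k f) ⟩
      k f                                ∎

  -- The codeword and its orphan weigh 18 N each, the n - 2 sons 9 N each, and the father 18. This
  -- exceeds `target` by 18, that is, the share bound by 1 / (n - 1).
  special-share : ∀ {c} → Special c → share C c ℚ.≤ (target + 18) // d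
  special-share {c} sp = share-ω (begin
    ω (K c) + sum (ω ∘ k)             ≡⟨ cong (λ x → ω x + sum (ω ∘ k)) Kc ⟩
    18 * N + sum (ω ∘ k)              ≤⟨ ℕ.+-monoʳ-≤ (18 * N) (ℕ.+-cancelʳ-≤ (9 * N) _ _ neighbours) ⟩
    18 * N + (n * (9 * N) + 18)       ≡⟨ identity N n ⟩
    target + 18                       ∎)
    where
    open Special sp
    open ℕ.≤-Reasoning
    identity : ∀ N n → 18 * N + (n * (9 * N) + 18) ≡ N * (9 * (n + 2)) + 18
    identity = solve-∀
    identity₂ : ∀ N n → n * (9 * N) + (9 * N * 1 + 18 * 1) ≡ n * (9 * N) + 18 + 9 * N
    identity₂ = solve-∀

    -- Replacing 9 N by 18 at the father is a subtraction; it is expressed by adding 9 N on the left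
    -- there and cancelling it after summation.
    pointwise : ∀ i → ω (k i) + 9 * N * ⟦ 3 ≤ᵇ k i ⟧ ≤ 9 * N + (9 * N * ⟦ k i ≡ᵇ 1 ⟧ + 18 * ⟦ 3 ≤ᵇ k i ⟧)
    pointwise i with 3 ≤ᵇ k i in eq
    ... | true  = begin
      ω (k i) + 9 * N * 1                     ≡⟨ cong₂ _+_ (ω-large (subst (λ j → N ≤ k j) (sym (f-only (≤ᵇ-true⁻ {3} {k i} eq))) N≤Kf)) (ℕ.*-identityʳ (9 * N)) ⟩
      18 + 9 * N                              ≡⟨ ℕ.+-comm 18 (9 * N) ⟩
      9 * N + 18                              ≤⟨ ℕ.+-monoʳ-≤ (9 * N) (ℕ.m≤n+m 18 _) ⟩
      9 * N + (9 * N * ⟦ k i ≡ᵇ 1 ⟧ + 18)     ∎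
    ... | false with k i | dominating (flip c i)
    ...   | 1 | _ = ℕ.≤-reflexive (identity₃ N)
      where
      identity₃ : ∀ N → 18 * N + 9 * N * 0 ≡ 9 * N + (9 * N * 1 + 18 * 0)
      identity₃ = solve-∀
    ...   | 2 | _ = ℕ.+-mono-≤ (ω-≤ ℕ.≤-refl) (ℕ.m≤m+n (9 * N * 0) 0)
    ...   | suc (suc (suc _)) | _ with () ← eq

    neighbours : sum (ω ∘ k) + 9 * N ≤ n * (9 * N) + 18 + 9 * N
    neighbours = begin
      sum (ω ∘ k) + 9 * N                 ≡⟨ cong (sum (ω ∘ k) +_) (trans (cong (9 * N *_) one-father) (ℕ.*-identityʳ (9 * N))) ⟨
      sum (ω ∘ k) + 9 * N * fathers       ≡⟨ cong (sum (ω ∘ k) +_) (*-distribˡ-sum (9 * N) (λ i → ⟦ 3 ≤ᵇ k i ⟧)) ⟩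
      sum (ω ∘ k) + sum (λ i → 9 * N * ⟦ 3 ≤ᵇ k i ⟧)       ≡⟨ ∑-distrib-+ (ω ∘ k) _ ⟨
      sum (λ i → ω (k i) + 9 * N * ⟦ 3 ≤ᵇ k i ⟧)           ≤⟨ sum-mono pointwise ⟩
      sum (λ i → 9 * N + (9 * N * ⟦ k i ≡ᵇ 1 ⟧ + 18 * ⟦ 3 ≤ᵇ k i ⟧))
        ≡⟨ ∑-distrib-+ (λ _ → 9 * N) (λ i → 9 * N * ⟦ k i ≡ᵇ 1 ⟧ + 18 * ⟦ 3 ≤ᵇ k i ⟧) ⟩
      sum {n} (λ _ → 9 * N) + sum (λ i → 9 * N * ⟦ k i ≡ᵇ 1 ⟧ + 18 * ⟦ 3 ≤ᵇ k i ⟧)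
        ≡⟨ cong₂ _+_ (sum-const n (9 * N)) (sum-linear (9 * N) 18 (λ i → ⟦ k i ≡ᵇ 1 ⟧) (λ i → ⟦ 3 ≤ᵇ k i ⟧)) ⟩
      n * (9 * N) + (9 * N * orphans + 18 * fathers)
        ≤⟨ ℕ.+-monoʳ-≤ (n * (9 * N)) (ℕ.+-mono-≤ (ℕ.*-monoʳ-≤ (9 * N) (orphans≤1 Cc)) (ℕ.≤-reflexive (cong (18 *_) one-father))) ⟩
      n * (9 * N) + (9 * N * 1 + 18 * 1)  ≡⟨ identity₂ N n ⟩
      n * (9 * N) + 18 + 9 * N            ∎

  codeword-share : ∀ {c} → C c ≡ true → share C c ℚ.≤ (target + 18) // d
  codeword-share {c} Cc with isSpecial C c in eq
  ... | true  = special-share (special⁻ eq)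
  ... | false = ℚ.≤-trans (nonspecial-share Cc eq)
    (//-monoˡ d (ℕ.m≤m+n target 18))

  -- Special fathers

  record SpecialFather (u : Word n) : Set where
    field
      m      : Fin n
      sp     : Special (flip u m)
      m≡f    : m ≡ Special.f sp
      Cu     : C u ≡ false
      N≤Ku   : N ≤ K u
      Ku≤N   : K u ≤ N
      p      : Fin n
      p-only : ∀ {l} → l ≢ p → C (flip u l) ≡ true
      q      : Fin n
      q≢p    : q ≢ p
      Cpq    : C (flip (flip u p) q) ≡ true

    -- The codeword whose low share pays for the special ones: its neighbour a + p = u + p + q is a
    -- codeword too, so `a` is not isolated.
    a : Word n
    a = flip u q

    3≤Ku : 3 ≤ K u
    3≤Ku = ℕ.≤-trans (ℕ.≤-trans (ℕ.m≤m+n 3 6) 9≤N) N≤Ku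

    Ca : C a ≡ true
    Ca = p-only q≢p

    Cap : C (flip a p) ≡ true
    Cap = trans (cong C (flip-comm u q p)) Cpq

    -- The word a + p is a codeword adjacent to the codeword `a`. For other l, the word u + q + l is
    -- adjacent to the two codewords u + q and u + l.
    2≤K-around : ∀ l → l ≢ q → 2 ≤ K (flip a l)
    2≤K-around l l≢q with l ≟F p
    ... | yes refl = two≤cardI C (inI-self C Cap) (inI-unflip C p Ca) (flip≢ a p ∘ sym)
    ... | no  l≢p  = two≤cardI C (inI-unflip C l Ca)
      (subst (λ x → inI C x (flip u l) ≡ true) (flip-comm u l q) (inI-unflip C q (p-only l≢p)))
      (l≢q ∘ flip-injective u)

    -- The word u = a + q weighs 18 because its I-set has at least N elements. The other n words of
    -- the ball, `a` included, have I-sets of size at least 2 and weigh at most 9 N each.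
    a-share : share C a ℚ.≤ (n * (9 * N) + 18) // d
    a-share = share-ω {a} (begin
      ω (K a) + sum (λ l → ω (K (flip a l)))
        ≤⟨ ℕ.+-monoˡ-≤ _ (ω-≤ (two≤cardI C (inI-self C Ca) (inI-flip C p Cap) (flip≢ a p))) ⟩
      9 * N + sum (λ l → ω (K (flip a l)))
        ≡⟨ cong (9 * N +_) (sum-avoiding q (λ l → ω (K (flip a l)))) ⟩
      9 * N + (ω (K (flip a q)) + sum (avoiding q (λ l → ω (K (flip a l)))))
        ≤⟨ ℕ.+-monoʳ-≤ (9 * N) (ℕ.+-mono-≤ (ℕ.≤-reflexive (trans (cong (ω ∘ K) (flip-flip u q)) (ω-large N≤Ku))) (sum-mono others)) ⟩
      9 * N + (18 + sum (avoiding q (λ _ → 9 * N)))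
        ≡⟨ x∙yz≈y∙xz (9 * N) 18 _ ⟩
      18 + (9 * N + sum (avoiding q (λ _ → 9 * N)))
        ≡⟨ cong (18 +_) (sum-avoiding q (λ _ → 9 * N)) ⟨
      18 + sum {n} (λ _ → 9 * N)
        ≡⟨ cong (18 +_) (sum-const n (9 * N)) ⟩
      18 + n * (9 * N)
        ≡⟨ ℕ.+-comm 18 _ ⟩
      n * (9 * N) + 18 ∎)
      where
      open ℕ.≤-Reasoning
      others : ∀ l → avoiding q (λ l → ω (K (flip a l))) l ≤ avoiding q (λ _ → 9 * N) l
      others l with l ≟F q
      ... | yes _   = z≤n
      ... | no  l≢q = ω-≤ (2≤K-around l l≢q)

  module _ {u m} (3≤Ku : 3 ≤ K u) (sp : Special (flip u m)) where

    private
      module S = Special sp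
      p = S.o

      m≡f : m ≡ S.f
      m≡f = S.f-only (subst (λ x → 3 ≤ K x) (sym (flip-flip u m)) 3≤Ku)

      Cu : C u ≡ false
      Cu = trans (cong C (sym (flip-flip u m))) (S.noncode m)

      N≤Ku : N ≤ K u
      N≤Ku = subst (λ x → N ≤ K x) (trans (cong (flip (flip u m)) (sym m≡f)) (flip-flip u m)) S.N≤Kf

      -- A codeword u + p would be a second codeword adjacent to the orphan of the special codeword.
      Cp : C (flip u p) ≡ false
      Cp = ¬-not λ e → contradiction
        (subst (2 ≤_) S.Ko (proj₂ (S.edge⇒2≤k (S.f≢o ∘ trans (sym m≡f))
          (trans (cong (λ x → C (flip x p)) (flip-flip u m)) e))))
        λ { (s≤s ()) }

      -- As `u` is not a codeword, `K u` counts only neighbours. With K u ≥ N this leaves at most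
      -- one non-codeword neighbour, and u + p is one.
      code+noncode : K u + sum (λ l → ⟦ not (C (flip u l)) ⟧) ≡ N + 1
      code+noncode = begin
        K u + sum (λ l → ⟦ not (C (flip u l)) ⟧)
          ≡⟨ cong (_+ sum (λ l → ⟦ not (C (flip u l)) ⟧)) (cardI-flip C Cu) ⟩
        sum (λ l → ⟦ C (flip u l) ⟧) + sum (λ l → ⟦ not (C (flip u l)) ⟧)
          ≡⟨ ∑-distrib-+ (λ l → ⟦ C (flip u l) ⟧) _ ⟨
        sum (λ l → ⟦ C (flip u l) ⟧ + ⟦ not (C (flip u l)) ⟧)
          ≡⟨ sum-cong-≗ (λ l → b+¬b (C (flip u l))) ⟩
        sum {n} (λ _ → 1)
          ≡⟨ trans (sum-const n 1) (ℕ.*-identityʳ n) ⟩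
        n
          ≡⟨ trans n≡1+N (ℕ.+-comm 1 N) ⟩
        N + 1 ∎
        where
        open ≡-Reasoning
        b+¬b : ∀ b → ⟦ b ⟧ + ⟦ not b ⟧ ≡ 1
        b+¬b true  = refl
        b+¬b false = refl

      p-only : ∀ {l} → l ≢ p → C (flip u l) ≡ true
      p-only {l} l≢p with C (flip u l) in eq
      ... | true  = refl
      ... | false = contradiction
        (sum-⟦⟧≤1⁻ (λ l → not (C (flip u l))) noncode≤1 (cong not eq) (cong not Cp)) l≢p
        where
        noncode≤1 : sum (λ l → ⟦ not (C (flip u l)) ⟧) ≤ 1
        noncode≤1 = ℕ.+-cancelˡ-≤ N _ 1 (ℕ.≤-trans (ℕ.+-monoˡ-≤ _ N≤Ku) (ℕ.≤-reflexive code+noncode))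

      Ku≤N : K u ≤ N
      Ku≤N = ℕ.+-cancelʳ-≤ 1 (K u) N (ℕ.≤-trans
        (ℕ.+-monoʳ-≤ (K u) (ℕ.≤-trans (ℕ.≤-reflexive (cong (⟦_⟧ ∘ not) (sym Cp))) (term≤sum (λ l → ⟦ not (C (flip u l)) ⟧) p)))
        (ℕ.≤-reflexive code+noncode))

    father-of-special : SpecialFather u
    -- The non-codeword u + p is dominated by some neighbour u + p + q; here q differs from p
    -- because u + p + p = u is not in the code.
    father-of-special with q , 1≤Cpq ← positive-term (λ q → ⟦ C (flip (flip u p) q) ⟧)
                              (subst (1 ≤_) (cardI-flip C Cp) (dominating (flip u p))) = record
      { m = m ; sp = sp ; m≡f = m≡f ; Cu = Cu ; N≤Ku = N≤Ku ; Ku≤N = Ku≤N ; p = p ; p-only = p-only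
      ; q = q ; q≢p = q≢p ; Cpq = 1≤⟦⟧⇒true 1≤Cpq }
      where
      q≢p : q ≢ p
      q≢p q≡p = true≢false (1≤⟦⟧⇒true 1≤Cpq)
        (trans (cong C (trans (cong (flip (flip u p)) q≡p) (flip-flip u p))) Cu)

  specialFather⁻ : ∀ {u} → isSpecialFather C u ≡ true → SpecialFather u
  specialFather⁻ {u} h
    with father , near-special ← ∧-true {isFather C u} h
    with c , hc ← any-true⁻ (λ c → inN c u ∧ isSpecial C c) (allWords n) near-special
    with c∈ , special ← ∧-true {inN c u} hc
    with m , c≡ ← inN⇒flip {u = c} {u} c∈
    = father-of-special (≤ᵇ-true⁻ father) (subst Special c≡ (special⁻ special))

  module _ {u : Word n} (U : SpecialFather u) where
    private module U = SpecialFather U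
    open U using (a; p; q)

    -- Let c′ = a + k + m be the special codeword next to the supposed special father a + k. Each
    -- position of `m` contradicts that c′ is isolated or has a father in direction m only.
    no-other-special-father : ∀ {k} → k ≢ q → k ≢ p → ¬ SpecialFather (flip a k)
    no-other-special-father {k} k≢q k≢p V = impossible (m ≟F q) (m ≟F k) (m ≟F p)
      where
      open SpecialFather V using (m; sp; m≡f)
      module S = Special sp
      c′ = flip (flip a k) m

      c′-flip-k : flip c′ k ≡ flip a m
      c′-flip-k = trans (flip-comm (flip a k) m k) (cong (λ x → flip x m) (flip-flip a k))

      c′-edge : flip (flip c′ k) q ≡ flip u m
      c′-edge = trans (cong (λ x → flip x q) c′-flip-k)
        (trans (flip-comm a m q) (cong (λ x → flip x m) (flip-flip u q)))

      impossible : Dec (m ≡ q) → Dec (m ≡ k) → Dec (m ≡ p) → ⊥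
      -- Here c′ = u + k, so `u` is a father next to c′ in direction k, which must then be m = q.
      impossible (yes m≡q) _ _ = k≢q (trans (S.f-only (subst (λ x → 3 ≤ K x) (sym c′-k≡u) U.3≤Ku)) (trans (sym m≡f) m≡q))
        where
        c′-k≡u : flip c′ k ≡ u
        c′-k≡u = trans c′-flip-k (trans (cong (flip a) m≡q) (flip-flip u q))
      -- Here c′ = a, which has the codeword neighbour a + p.
      impossible (no _) (yes m≡k) _ = true≢false
        (trans (cong (λ x → C (flip x p)) (trans (cong (flip (flip a k)) m≡k) (flip-flip a k))) U.Cap) (S.noncode p)
      -- Here c′ + k = a + p is a codeword next to the isolated c′.
      impossible (no _) (no _) (yes m≡p) = true≢false
        (trans (cong C (trans c′-flip-k (cong (flip a) m≡p))) U.Cap) (S.noncode k)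
      -- Now c′ + k + q = u + m is a codeword, so {k, q} is an edge in the graph of c′; one of its
      -- ends must be the father direction m.
      impossible (no m≢q) (no m≢k) (no m≢p) with S.edge⇒f k≢q (trans (cong C c′-edge) (U.p-only m≢p))
      ... | inj₁ k≡f = m≢k (trans m≡f (sym k≡f))
      ... | inj₂ q≡f = m≢q (trans m≡f (sym q≡f))

    -- This places `a` in C'(u). The words `a` and a + p are codewords, whereas special fathers are
    -- not.
    only-special-father : ∀ {v} → inN[] v a ≡ true → SpecialFather v → v ≡ u
    only-special-father {v} v∈ V with inN[]⇒flip {u = v} {a} v∈
    ... | inj₁ refl = ⊥-elim (true≢false U.Ca (SpecialFather.Cu V))
    ... | inj₂ (k , refl) with k ≟F q | k ≟F p
    ...   | yes refl | _        = flip-flip u q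
    ...   | no _     | yes refl = ⊥-elim (true≢false U.Cap (SpecialFather.Cu V))
    ...   | no k≢q   | no k≢p   = ⊥-elim (no-other-special-father k≢q k≢p V)

  -- The averages and the final bound

  ==-refl : ∀ {v u : Word n} → v ≡ u → (v == u) ≡ true
  ==-refl {v} {u} v≡u with ≡-dec _≟B_ v u
  ... | yes _   = refl
  ... | no  v≢u = contradiction v≡u v≢u

  inC'⁺ : ∀ {u c} → inI C u c ≡ true → (∀ {v} → inN[] v c ≡ true → isSpecialFather C v ≡ true → v ≡ u) →
          inC' C u c ≡ true
  inC'⁺ {u} {c} c∈ only = ∧-intro c∈ (all-true⁺ _ (allWords n) λ v →
    implication⁺ λ h → ==-refl (only (proj₁ (∧-true {inN[] v c} h)) (proj₂ (∧-true {inN[] v c} h))))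

  -- Every codeword of C'(u) weighs at most `target` + 18, and `a` stays 18 N below that. As C'(u)
  -- is contained in I(u), it has at most N elements, so the excesses of 18 add up to at most 18 N.
  avgShare-≤ : ∀ {u} → SpecialFather u → avgShare C u ℚ.≤ (n + 2) // 1
  avgShare-≤ {u} U = average-≤ C {g = bound} {b = n + 2} {e = 1} L a∈L share-bound scaled
    where
    open SpecialFather U
    open ℕ.≤-Reasoning
    L = C'list C u

    a∈L : a ∈ L
    a∈L = ∈-filter⁺ (λ c → inC' C u c ≟B true) (∈-allWords a)
      (inC'⁺ (inI-flip C q Ca) (λ v∈ hv → only-special-father U v∈ (specialFather⁻ hv)))

    bound : Word n → ℕ
    bound x = if x == a then n * (9 * N) + 18 else target + 18

    gap : n * (9 * N) + 18 + 18 * N ≡ target + 18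
    gap = identity N n
      where
      identity : ∀ N n → n * (9 * N) + 18 + 18 * N ≡ N * (9 * (n + 2)) + 18
      identity = solve-∀

    bound-≤ : ∀ x → bound x ≤ target + 18
    bound-≤ x with x == a
    ... | true  = ℕ.≤-trans (ℕ.m≤m+n _ (18 * N)) (ℕ.≤-reflexive gap)
    ... | false = ℕ.≤-refl

    bound-a : bound a + 18 * N ≤ target + 18
    bound-a rewrite ==-refl {a} refl = ℕ.≤-reflexive gap

    share-bound : ∀ {x} → x ∈ L → share C x ℚ.≤ bound x // d
    share-bound {x} x∈ with ≡-dec _≟B_ x a
    ... | yes refl = a-share
    ... | no  _    = codeword-share (inI⇒C C (proj₁ (∧-true (proj₂ (∈-filter⁻ (λ c → inC' C u c ≟B true) {xs = allWords n} x∈)))))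

    length≤N : length L ≤ N
    length≤N = begin
      length L                             ≡⟨ length-filter (inC' C u) (allWords n) ⟩
      Σ[ allWords n ] (⟦_⟧ ∘ inC' C u)     ≤⟨ Σ-mono (allWords n) (λ x → weaken (inI C u x) _) ⟩
      Σ[ allWords n ] (⟦_⟧ ∘ inI C u)      ≡⟨ length-filter (inI C u) (allWords n) ⟨
      K u                                  ≤⟨ Ku≤N ⟩
      N                                    ∎
      where
      weaken : ∀ a b → ⟦ a ∧ b ⟧ ≤ ⟦ a ⟧
      weaken true  b = ⟦⟧≤1 b
      weaken false b = z≤n

    total : Σ[ L ] bound ≤ length L * target
    total = ℕ.+-cancelʳ-≤ (18 * N) _ _ (begin
      Σ[ L ] bound + 18 * N                  ≤⟨ Σ-gap bound L bound-≤ a∈L bound-a ⟩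
      length L * (target + 18)               ≡⟨ ℕ.*-distribˡ-+ (length L) target 18 ⟩
      length L * target + length L * 18      ≤⟨ ℕ.+-monoʳ-≤ _ (ℕ.*-monoˡ-≤ 18 length≤N) ⟩
      length L * target + N * 18             ≡⟨ cong (length L * target +_) (ℕ.*-comm N 18) ⟩
      length L * target + 18 * N             ∎)

    scaled : (Σ[ L ] bound) * 2 ≤ (n + 2) * (suc d * length L)
    scaled = begin
      (Σ[ L ] bound) * 2                ≤⟨ ℕ.*-monoˡ-≤ 2 total ⟩
      length L * target * 2             ≡⟨ identity (length L) N (n + 2) ⟩
      (n + 2) * (18 * N * length L)     ≡⟨ cong (λ x → (n + 2) * (x * length L)) 1+d≡18N ⟨
      (n + 2) * (suc d * length L)      ∎
      where
      identity : ∀ l N m → l * (N * (9 * m)) * 2 ≡ m * (18 * N * l)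
      identity = solve-∀

  -- Every special codeword takes part in an average: c + f is the only father in its closed ball,
  -- `c` itself having K c = 1.
  special-inC' : ∀ {c} → isSpecial C c ≡ true → Special c → ∃ λ u → isSpecialFather C u ∧ inC' C u c ≡ true
  special-inC' {c} h sp = u , ∧-intro
    (∧-intro (≤ᵇ-true⁺ 3≤Kf)
      (any-true⁺ _ (∈-allWords c) (∧-intro (subst (λ x → inN x u ≡ true) (flip-flip c f) (inN-flip u f)) h)))
    (inC'⁺ (inI-unflip C f Cc) only)
    where
    open Special sp
    u = flip c f
    only : ∀ {v} → inN[] v c ≡ true → isSpecialFather C v ≡ true → v ≡ u
    only {v} v∈ hv with 3≤Kv ← ≤ᵇ-true⁻ {3} {K v} (proj₁ (∧-true {isFather C v} hv)) with inN[]⇒flip {u = v} {c} v∈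
    ... | inj₁ refl       = contradiction (subst (3 ≤_) Kc 3≤Kv) λ { (s≤s ()) }
    ... | inj₂ (i , refl) = cong (flip c) (f-only 3≤Kv)

  -- The invariant of the recursion over the list: the share is small already, or a special father
  -- `u` with c in C'(u) is still ahead. Whichever such father comes first, `avgShare-≤` bounds its
  -- average.
  Averaged : Word n → List (Word n) → Set
  Averaged c us = share C c ℚ.≤ (n + 2) // 1 ⊎ ∃ λ u → u ∈ us × isSpecialFather C u ∧ inC' C u c ≡ true

  averaged : ∀ c → C c ≡ true → Averaged c (allWords n)
  averaged c Cc with isSpecial C c in eq
  ... | false = inj₁ (ℚ.≤-trans (nonspecial-share Cc eq) target≤)
  ... | true  = inj₂ (Product.map₂ (∈-allWords _ ,_) (special-inC' eq (special⁻ eq)))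

  redistribute-≤ : ∀ {c} us → Averaged c us → redistribute C c us ℚ.≤ (n + 2) // 1
  redistribute-≤ [] (inj₁ s) = s
  redistribute-≤ {c} (u ∷ us) av with isSpecialFather C u ∧ inC' C u c in eq
  ... | true  = avgShare-≤ (specialFather⁻ (proj₁ (∧-true {isSpecialFather C u} eq)))
  ... | false = redistribute-≤ us (later av)
    where
    later : Averaged c (u ∷ us) → Averaged c us
    later (inj₁ s)                     = inj₁ s
    later (inj₂ (_ , here refl , hu))  = ⊥-elim (true≢false hu eq)
    later (inj₂ (v , there v∈ , hv))   = inj₂ (v , v∈ , hv)

  shareAfter-≤ : ∀ {c} → C c ≡ true → shareAfter C c ℚ.≤ (n + 2) // 1
  shareAfter-≤ {c} Cc = subst (ℚ._≤ (n + 2) // 1) (sym (shareAfter≡redistribute C c))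
    (redistribute-≤ (allWords n) (averaged c Cc))

theorem5 : (n : ℕ) → 10 ≤ n → (C : Code n) → IsLocatingDominating C
    → (c : Word n) → C c ≡ true
    → shareAfter C c ℚ.≤ ((ℤ.+ n / 2) ℚ.+ 1ℚ)
-- The inner `s≤s` shows that `N` is a successor, so 18 N computes to a successor and the second
-- `refl` determines `d` as 18 N - 1.
theorem5 (suc N) (s≤s 9≤N@(s≤s _)) C ld c Cc =
  subst (shareAfter C c ℚ.≤_) (sym (n/2+1 (suc N))) (shareAfter-≤ 9≤N refl refl C ld Cc)
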